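{- The equality $\operatorname{ind}A(K/F)=p^{m(K/F)+1}$ does not hold in general: there exist a prime $p$, an integer $n\ge 1$, and a cyclic Galois extension $K/F$ of degree $p^n$ with $\operatorname{char}F\ne p$ and $F$ containing a primitive $p$th root of unity $\xi_p$, with $\operatorname{Gal}(K/F)=\langle\sigma\rangle$, such that $m(K/F)\neq-\infty$ and the cyclic algebra $A(K/F)=(K/F,\sigma,\xi_p)$ satisfies $$\operatorname{ind}A(K/F)<p^{m(K/F)+1}.$$
   Context: Let $p$ be a prime and $K/F$ a cyclic Galois extension of degree $p^n$, $n\ge 1$, with $\operatorname{char}F\ne p$ and $F$ containing a primitive $p$th root of unity $\xi_p$. For $0\le i\le n$ let $K_i$ be the unique intermediate field $F\subseteq K_i\subseteq K$ with $[K_i:F]=p^i$. Define $$m(K/F)=\begin{cases}-\infty, & \xi_p\in N_{K/F}(K^\times),\\ \min\{s\in\{0,\dots,n\} : \xi_p\in N_{K/K_s}(K^\times)\}-1, & \xi_p\notin N_{K/F}(K^\times).\end{cases}$$ For a cyclic extension $L/E$ of degree $r>1$ with $\operatorname{Gal}(L/E)=\langle\tau\rangle$ and $b\in E^\times$, the cyclic algebra $(L/E,\tau,b)$ is the central simple $E$-algebra $\bigoplus_{0\le j<r}u^jL$ with $u^{ -1}du=\tau(d)$ for all $d\in L$ and $u^r=b$. If $B$ is a central simple $E$-algebra with $B\simeq M_s(D)$, $D$ a division algebra, its Schur index is $\operatorname{ind}B=\sqrt{\dim_E D}$. -}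

module Defs where

open import Algebra.Apartness.Bundles using (HeytingField; HeytingCommutativeRing)
open import Algebra.Bundles using (CommutativeRing; Ring; RawRing)
import Algebra.Definitions.RawSemiring as RawSemiringDefs
open import Algebra.Morphism.Structures using (module RingMorphisms)
open import Data.Bool.Base using (if_then_else_)
open import Data.Fin.Base using (Fin; toℕ)
open import Data.Fin.Properties using (_≟_)
open import Data.Nat.Base as ℕ using (ℕ; suc)
open import Data.Nat.Divisibility using (_∣_)
open import Data.Nat.GeneralisedArithmetic using (iterate)
open import Data.Product using (Σ-syntax; ∃-syntax; ∃!; _×_)
open import Data.Vec.Functional using (Vector)
open import Data.Vec.Functional.Relation.Binary.Pointwise using (Pointwise)
open import Function.Bundles using (_⇔_)
open import Function.Definitions using (Bijective)
open import Level using (0ℓ)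
open import Relation.Binary.PropositionalEquality.Core using (_≡_)
open import Relation.Nullary.Construct.Add.Infimum using (_₋; ⊥₋; [_])
open import Relation.Nullary.Decidable.Core using (does)
open import Relation.Nullary.Negation.Core using (¬_)

-- Nontriviality is built into HeytingField: in the zero ring 0 - 0 is
-- invertible, so 0 # 0.  The unit group is { x | x # 0# }.
Field : Set₁
Field = HeytingField 0ℓ 0ℓ 0ℓ

module Field (F : Field) where
  open HeytingField F public using (_#_)
  open CommutativeRing
    (HeytingCommutativeRing.commutativeRing (HeytingField.heytingCommutativeRing F)) public
  open RawSemiringDefs (RawRing.rawSemiring rawRing) public
    using (_^_; product) renaming (_×_ to _·_)

-- The kernel of ℤ → F is generated by q.
HasCharacteristic : Field → ℕ → Set
HasCharacteristic F q = ∀ k → (k · 1# ≈ 0#) ⇔ (q ∣ k)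
  where open Field F

IsPrimitiveRoot : (F : Field) → ℕ → Field.Carrier F → Set
IsPrimitiveRoot F p ξ = (ξ ^ p ≈ 1#) × (∀ k → 0 ℕ.< k → k ℕ.< p → ¬ (ξ ^ k ≈ 1#))
  where open Field F

------------------------------------------------------------------------
-- Associative unital algebras over a field

record Algebra (F : Field) : Set₁ where
  private module F = Field F
  field
    ring : Ring 0ℓ 0ℓ
  open Ring ring public
  open RawSemiringDefs (RawRing.rawSemiring rawRing) public using (_^_; sum)
  open RingMorphisms F.rawRing rawRing using (IsRingHomomorphism)
  field
    algebraMap         : F.Carrier → Carrier
    isRingHomomorphism : IsRingHomomorphism algebraMap
    central            : ∀ c a → algebraMap c * a ≈ a * algebraMap c

HasDimension : {F : Field} → Algebra F → ℕ → Set
HasDimension {F} A d =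
  Σ[ e ∈ Vector Carrier d ] ∀ a →
    ∃! (Pointwise F._≈_) λ (c : Vector F.Carrier d) →
      sum (λ i → algebraMap (c i) * e i) ≈ a
  where
  module F = Field F
  open Algebra A

IsDivisionAlgebra : {F : Field} → Algebra F → Set
IsDivisionAlgebra D =
  ¬ (1# ≈ 0#) × (∀ a → ¬ (a ≈ 0#) → ∃[ b ] (b * a ≈ 1#) × (a * b ≈ 1#))
  where open Algebra D

diagonal : {F : Field} (D : Algebra F) (s : ℕ) → Algebra.Carrier D →
           Fin s → Fin s → Algebra.Carrier D
diagonal D s a i j = if does (i ≟ j) then a else 0#
  where open Algebra D

matrixRing : {F : Field} → ℕ → Algebra F → RawRing 0ℓ 0ℓ
matrixRing s D = record
  { Carrier = Fin s → Fin s → Carrier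
  ; _≈_     = λ x y → ∀ i j → x i j ≈ y i j
  ; _+_     = λ x y i j → x i j + y i j
  ; _*_     = λ x y i j → sum (λ k → x i k * y k j)
  ; -_      = λ x i j → - x i j
  ; 0#      = λ i j → 0#
  ; 1#      = diagonal D s 1#
  }
  where open Algebra D

-- Isomorphism B ≃ M_s(D) of F-algebras.
record IsMatrixAlgebra {F : Field} (B : Algebra F) (s : ℕ) (D : Algebra F) : Set where
  private
    module F = Field F
    module B = Algebra B
    module D = Algebra D
    module M = RawRing (matrixRing s D)
  open RingMorphisms B.rawRing (matrixRing s D) using (IsRingIsomorphism)
  field
    to                : B.Carrier → M.Carrier
    isRingIsomorphism : IsRingIsomorphism to
    to-algebraMap     : ∀ c → to (B.algebraMap c) M.≈ diagonal D s (D.algebraMap c)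

-- ind B = d.  For central simple B such s and D exist, and D is unique up
-- to isomorphism, by Wedderburn's theorem.
IsSchurIndex : {F : Field} → Algebra F → ℕ → Set₁
IsSchurIndex {F} B d =
  ∃[ s ] Σ[ D ∈ Algebra F ]
    IsDivisionAlgebra D × HasDimension D (d ℕ.* d) × IsMatrixAlgebra B s D

------------------------------------------------------------------------
-- Field extensions

record Extension (F K : Field) : Set where
  private
    module F = Field F
    module K = Field K
  open RingMorphisms F.rawRing K.rawRing using (IsRingHomomorphism)
  field
    embed              : F.Carrier → K.Carrier
    isRingHomomorphism : IsRingHomomorphism embed

extensionAlgebra : {F K : Field} → Extension F K → Algebra F
extensionAlgebra {K = K} K/F = record
  { ring               = Field.ring K
  ; algebraMap         = embed
  ; isRingHomomorphism = isRingHomomorphism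
  ; central            = λ c a → Field.*-comm K (embed c) a
  }
  where open Extension K/F

HasDegree : {F K : Field} → Extension F K → ℕ → Set
HasDegree K/F = HasDimension (extensionAlgebra K/F)

record Gal {F K : Field} (K/F : Extension F K) : Set where
  private
    module F = Field F
    module K = Field K
  open Extension K/F using (embed)
  open RingMorphisms K.rawRing K.rawRing using (IsRingIsomorphism)
  field
    apply             : K.Carrier → K.Carrier
    isRingIsomorphism : IsRingIsomorphism apply
    fixesBase         : ∀ c → apply (embed c) K.≈ embed c

open Gal public using (apply)

module _ {F K : Field} (K/F : Extension F K) where
  private
    module F = Field F
    module K = Field K
  open Extension K/F using (embed)

  _≈ᴳ_ : Gal K/F → Gal K/F → Set
  τ ≈ᴳ τ′ = ∀ x → apply τ x K.≈ apply τ′ x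

  -- The fixed field of Gal(K/F) is F.
  IsGalois : Set
  IsGalois = ∀ x → (∀ (τ : Gal K/F) → apply τ x K.≈ x) → ∃[ c ] embed c K.≈ x

  -- Natural exponents suffice, as the groups considered are finite.
  IsGenerator : Gal K/F → Set
  IsGenerator σ = ∀ (τ : Gal K/F) → ∃[ k ] ∀ x → apply τ x K.≈ iterate (apply σ) x k

  IsCyclicGalois : ℕ → Gal K/F → Set
  IsCyclicGalois r σ = HasDegree K/F r × IsGalois × IsGenerator σ

  -- N_{K/F}(x) = b for a finite Galois extension: the norm is the product of
  -- the conjugates of x over an enumeration of Gal(K/F).
  IsNorm : K.Carrier → F.Carrier → Set
  IsNorm x b =
    ∃[ k ] Σ[ τ ∈ Vector (Gal K/F) k ]
      Bijective _≡_ _≈ᴳ_ τ × (embed b K.≈ K.product (λ i → apply (τ i) x))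

  -- b ∈ N_{K/F}(K^×)
  InNormGroup : F.Carrier → Set
  InNormGroup b = ∃[ x ] (x K.# K.0#) × IsNorm x b

record IntermediateField {F K : Field} (K/F : Extension F K) : Set₁ where
  private
    module F = Field F
    module K = Field K
  field
    E   : Field
    E/F : Extension F E
    K/E : Extension E K
    compatible : ∀ c → Extension.embed K/E (Extension.embed E/F c) K.≈ Extension.embed K/F c

-- Kᵢ is determined by its degree, since K/F is cyclic of degree pⁿ.
record Tower {F K : Field} (K/F : Extension F K) (p n : ℕ) : Set₁ where
  field
    level  : Fin (suc n) → IntermediateField K/F
    degree : ∀ i → HasDegree (IntermediateField.E/F (level i)) (p ℕ.^ toℕ i)

module _ {F K : Field} {K/F : Extension F K} {p n : ℕ} (T : Tower K/F p n) where
  open Tower T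

  -- ξ ∈ N_{K/K_s}(K^×)
  IsNormFromTopTo : Field.Carrier F → Fin (suc n) → Set
  IsNormFromTopTo ξ s = InNormGroup K/E (Extension.embed E/F ξ)
    where open IntermediateField (level s)

  -- The value m(K/F), with ⊥₋ for -∞.  In the second case the minimum s is
  -- not 0, because K_0 = F; so s - 1 is a natural number.
  IsM : Field.Carrier F → ℕ ₋ → Set
  IsM ξ ⊥₋    = InNormGroup K/F ξ
  IsM ξ [ m ] = ¬ InNormGroup K/F ξ ×
    Σ[ s ∈ Fin (suc n) ]
      IsNormFromTopTo ξ s ×
      (∀ t → IsNormFromTopTo ξ t → toℕ s ℕ.≤ toℕ t) ×
      toℕ s ≡ suc m

------------------------------------------------------------------------
-- Cyclic algebras

-- A is the cyclic algebra (L/E, τ, b), r = [L : E]; the listed properties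
-- determine A up to isomorphism of E-algebras.
record IsCyclicAlgebra {E L : Field} (L/E : Extension E L) (r : ℕ) (τ : Gal L/E)
                       (b : Field.Carrier E) (A : Algebra E) : Set where
  private
    module E = Field E
    module L = Field L
  open Algebra A hiding (isRingHomomorphism)
  open RingMorphisms L.rawRing rawRing using (IsRingHomomorphism)
  field
    embedL             : L.Carrier → Carrier
    isRingHomomorphism : IsRingHomomorphism embedL
    embedL-algebraMap  : ∀ c → embedL (Extension.embed L/E c) ≈ algebraMap c
    u u⁻¹              : Carrier
    inverseˡ           : u⁻¹ * u ≈ 1#
    inverseʳ           : u * u⁻¹ ≈ 1#
    conjugation        : ∀ d → u⁻¹ * embedL d * u ≈ embedL (apply τ d)
    power              : u ^ r ≈ algebraMap b
    -- A = ⊕_{0 ≤ j < r} uʲ L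
    decomposition      : ∀ a → ∃! (Pointwise L._≈_) λ (d : Vector L.Carrier r) →
                           sum (λ j → u ^ toℕ j * embedL (d j)) ≈ a

{-# OPTIONS --safe #-}
module Submission where

-- The counterexample has p = 2, F = ℚ and ξ = -1.  Let K = ℚ(β) with β² = -(2 + √2); it is
-- cyclic of degree 4, with σ(√2) = -√2 and σ(β) = (1 - √2) β, and its intermediate fields are
-- ℚ ⊂ L = ℚ(√2) ⊂ K.  The norm of y = a + b β from K to L is a² + (2 + √2) b², and its rational
-- part is a non-negative quadratic form in the coordinates of a and b, so it is never -1.  Since
-- N_{K/ℚ}(x) = N_{K/L}(x σ(x)), the element -1 is not a norm from K to ℚ either; hence m(K/ℚ) = 1.
-- On the other hand the cyclic algebra (K/ℚ, σ, -1) is M₂(ℍ) for the Hamilton quaternions ℍ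
-- over ℚ, with √2, β and u represented by
--   [ 0  1+i ; 1-i  0 ],   [ -k  -j ; -j  -j ],   [ 0  -1 ; -i  0 ],
-- so its index is 2 < 2².

open import Defs
open import Algebra.Apartness.Structures using (IsHeytingField)
open import Algebra.Bundles using (AbelianGroup; CommutativeMonoid; CommutativeRing; RawRing; Ring)
import Algebra.Construct.DirectProduct as DirectProduct
import Algebra.Morphism.Construct.Composition as Composition
import Algebra.Morphism.Construct.Identity as Identity
open import Algebra.Morphism.Structures using (module RingMorphisms)
import Algebra.Properties.CommutativeMonoid.Sum
import Algebra.Properties.CommutativeSemigroup
import Algebra.Properties.Group
import Algebra.Properties.Ring
import Algebra.Properties.Semiring.Sum
import Algebra.Solver.Ring.NaturalCoefficients.Default
open import Algebra.Structures using (IsCommutativeRing; IsRing)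
open import Data.Bool.Base using (if_then_else_)
open import Data.Fin using (#_)
open import Data.Fin.Base using (Fin; zero; suc; toℕ)
open import Data.Fin.Patterns
open import Data.Fin.Permutation using (Permutation; permutation)
import Data.Fin.Properties as Fin
open import Data.Integer.Base as ℤ using (+_)
import Data.Integer.Properties as ℤ
open import Data.Nat.Base as ℕ using (ℕ; zero; suc)
open import Data.Nat.Coprimality using (Coprime; recompute)
open import Data.Nat.Divisibility using (_∣_; divides; ∣-refl; m∣m*n)
open import Data.Nat.GeneralisedArithmetic using (fold; iterate)
open import Data.Nat.Primality using (Prime; prime?; euclidsLemma)
import Data.Nat.Properties as ℕ
import Data.Nat.Solver
open import Data.Product using (Σ-syntax; ∃-syntax; ∃!; _×_; _,_; proj₁; proj₂)
open import Data.Product.Relation.Binary.Pointwise.NonDependent using (×-decidable)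
open import Data.Rational.Base as ℚ using (ℚ; mkℚ; 0ℚ; 1ℚ; ½; 1/_; nonNegative; ≢-nonZero)
import Data.Rational.Properties as ℚ
import Data.Rational.Solver
open import Data.Rational.Unnormalised.Base using (*≡*)
import Data.Rational.Unnormalised.Properties as ℚᵘ
open import Data.Sum.Base using (_⊎_; inj₁; inj₂; [_,_]′; reduce)
open import Data.Vec.Base using (Vec; []; _∷_)
open import Data.Vec.Functional using (Vector)
open import Data.Vec.Functional.Relation.Binary.Pointwise using (Pointwise)
open import Function.Base using (_∘_; id)
open import Function.Bundles using (Equivalence)
open import Function.Definitions using (Bijective)
open import Level using (0ℓ)
open import Relation.Binary.Bundles using (DecSetoid)
open import Relation.Binary.Definitions using (Decidable)
import Relation.Binary.Properties.DecSetoid as DecSetoidProperties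
open import Relation.Binary.PropositionalEquality as ≡ using (_≡_)
import Relation.Binary.Reasoning.Setoid
open import Relation.Nullary.Construct.Add.Infimum using ([_])
open import Relation.Nullary.Decidable using (does; yes; no; dec-true; dec-false; from-yes; _→-dec_)
open import Relation.Nullary.Negation.Core using (¬_; contradiction)

-- The formula must fail wherever index and exponent coincide. Since ξ^p = 1, the p-th tensor power
-- of A(K/F) is split, so its exponent divides p. Over a number field the index equals the exponent
-- (Albert, Brauer, Hasse, Noether), so the index is at most p, and every cyclic K/F with m(K/F) ≥ 1
-- is a counterexample. For p = 2 and degree 4, m ≥ 1 says that -1 is not a norm from K to L. A sign
-- obstruction ensures this: K is a CM field with complex conjugation σ², so nonzero norms to the
-- totally real field L are totally positive. The class of (K/ℚ, σ, -1) ramifies exactly at 2 and at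
-- infinity, hence is that of ℍ, and degree 4 then forces M₂(ℍ). This theory is only the motivation.
-- The proof checks an explicit presentation of M₂(ℍ) and some sums of rational squares.

module Hom (R S : Ring 0ℓ 0ℓ) where
  private
    module R = Ring R
    module S = Ring S
  open RingMorphisms R.rawRing S.rawRing public

  abstract
    -- Zero and negatives are preserved automatically, by cancellation in the additive group of the
    -- target.
    mkHom : {f : R.Carrier → S.Carrier} →
            (∀ {x y} → x R.≈ y → f x S.≈ f y) →
            (∀ x y → f (x R.+ y) S.≈ f x S.+ f y) →
            (∀ x y → f (x R.* y) S.≈ f x S.* f y) →
            f R.1# S.≈ S.1# → IsRingHomomorphism f
    mkHom {f} f-cong +-homo *-homo 1-homo = record
      { isSemiringHomomorphism = record
        { isNearSemiringHomomorphism = record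
          { +-isMonoidHomomorphism = record
            { isMagmaHomomorphism = record
              { isRelHomomorphism = record { cong = f-cong }
              ; homo = +-homo
              }
            ; ε-homo = 0-homo
            }
          ; *-homo = *-homo
          }
        ; 1#-homo = 1-homo
        }
      ; -‿homo = λ x → inverseˡ-unique (f (R.- x)) (f x)
          (S.trans (S.sym (+-homo (R.- x) x)) (S.trans (f-cong (R.-‿inverseˡ x)) 0-homo))
      }
      where
      open Algebra.Properties.Group S.+-group using (inverseˡ-unique; identityˡ-unique)
      0-homo : f R.0# S.≈ S.0#
      0-homo = identityˡ-unique (f R.0#) (f R.0#)
        (S.trans (S.sym (+-homo R.0# R.0#)) (f-cong (R.+-identityˡ R.0#)))

    mkIso : {f : R.Carrier → S.Carrier} → IsRingHomomorphism f →
            {g : S.Carrier → R.Carrier} → (∀ {x y} → x S.≈ y → g x R.≈ g y) →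
            (∀ x → g (f x) R.≈ x) → (∀ y → f (g y) S.≈ y) → IsRingIsomorphism f
    mkIso f-hom {g} g-cong gf fg = record
      { isRingMonomorphism = record
        { isRingHomomorphism = f-hom
        ; injective = λ {x} {y} eq → R.trans (R.sym (gf x)) (R.trans (g-cong eq) (gf y))
        }
      ; surjective = λ y → g y , λ eq → S.trans (f-hom .IsRingHomomorphism.⟦⟧-cong eq) (fg y)
      }

-- Discrete fields and their quadratic extensions

record DiscreteField : Set₁ where
  field
    commutativeRing : CommutativeRing 0ℓ 0ℓ
  open CommutativeRing commutativeRing public
  infix 4 _≟_
  field
    _≟_     : Decidable _≈_
    1≉0     : ¬ (1# ≈ 0#)
    inverse : ∀ x → ¬ (x ≈ 0#) → ∃[ y ] y * x ≈ 1#

  open Algebra.Properties.Group +-group using (x∙y⁻¹≈ε⇒x≈y; x≈y⇒x∙y⁻¹≈ε)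
  open Algebra.Properties.Ring ring using (x[y-z]≈xy-xz)

  private
    decSetoid : DecSetoid 0ℓ 0ℓ
    decSetoid = record { isDecEquivalence = record { isEquivalence = isEquivalence ; _≟_ = _≟_ } }
  open DecSetoidProperties decSetoid using (≉-isApartnessRelation; ≉-tight)

  abstract
    -- Apartness is taken to be the negation of equality; decidability of equality makes it
    -- cotransitive and tight.
    isHeytingField : IsHeytingField _≈_ (λ x y → ¬ (x ≈ y)) _+_ _*_ -_ 0# 1#
    isHeytingField = record
      { isHeytingCommutativeRing = record
        { isCommutativeRing = isCommutativeRing
        ; isApartnessRelation = ≉-isApartnessRelation
        ; #⇒invertible = λ {x} {y} x≉y →
            let z , zx≈1 = inverse (x - y) (x≉y ∘ x∙y⁻¹≈ε⇒x≈y x y)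
            in z , zx≈1 , trans (*-comm _ z) zx≈1
        ; invertible⇒# = λ { (z , z[x-y]≈1 , _) x≈y →
            1≉0 (trans (sym z[x-y]≈1) (trans (*-congˡ (x≈y⇒x∙y⁻¹≈ε x≈y)) (zeroʳ z))) }
        }
      ; tight = ≉-tight
      }

  field′ : Field
  field′ = record { isHeytingField = isHeytingField }

  x*y≈0⇒y≈0 : ∀ {x y} → ¬ (x ≈ 0#) → x * y ≈ 0# → y ≈ 0#
  x*y≈0⇒y≈0 {x} {y} x≉0 xy≈0 =
    let z , zx≈1 = inverse x x≉0 in
    begin
      y            ≈⟨ *-identityˡ y ⟨
      1# * y       ≈⟨ *-congʳ zx≈1 ⟨
      z * x * y    ≈⟨ *-assoc z x y ⟩
      z * (x * y)  ≈⟨ *-congˡ xy≈0 ⟩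
      z * 0#       ≈⟨ zeroʳ z ⟩
      0#           ∎
    where open Relation.Binary.Reasoning.Setoid setoid

  -- If x + y is nonzero, it can be cancelled from (x + y)(x - y) = 0. This is what leaves a
  -- homomorphism only two choices for the image of a square root.
  x²≈y²⇒x≈±y : ∀ {x y} → x * x ≈ y * y → x ≈ y ⊎ x ≈ - y
  x²≈y²⇒x≈±y {x} {y} x²≈y² with x + y ≟ 0#
  ... | yes x+y≈0 = inj₂ (inverseˡ-unique x y x+y≈0)
    where open Algebra.Properties.Group +-group using (inverseˡ-unique)
  ... | no  x+y≉0 = inj₁ (x∙y⁻¹≈ε⇒x≈y x y (x*y≈0⇒y≈0 x+y≉0 (begin
    (x + y) * (x - y)                    ≈⟨ x[y-z]≈xy-xz (x + y) x y ⟩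
    (x + y) * x - (x + y) * y            ≈⟨ +-cong (distribʳ x x y) (-‿cong (distribʳ y x y)) ⟩
    (x * x + y * x) - (x * y + y * y)    ≈⟨ x≈y⇒x∙y⁻¹≈ε (trans (+-cong x²≈y² (*-comm y x)) (+-comm (y * y) (x * y))) ⟩
    0#                                   ∎)))
    where open Relation.Binary.Reasoning.Setoid setoid

-- Pairs (a , b) stand for a + b √d.
module QuadraticRing (R : CommutativeRing 0ℓ 0ℓ) (d : CommutativeRing.Carrier R) where
  open CommutativeRing R
  open Algebra.Solver.Ring.NaturalCoefficients.Default commutativeSemiring

  private
    +-pairs : AbelianGroup 0ℓ 0ℓ
    +-pairs = DirectProduct.abelianGroup +-abelianGroup +-abelianGroup
    Pair : Set
    Pair = Carrier × Carrier

  _⊛_ : Pair → Pair → Pair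
  (a , b) ⊛ (a′ , b′) = a * a′ + d * (b * b′) , a * b′ + b * a′

  abstract
    isCommutativeRing[√] : IsCommutativeRing (AbelianGroup._≈_ +-pairs) (AbelianGroup._∙_ +-pairs)
      _⊛_ (AbelianGroup._⁻¹ +-pairs) (0# , 0#) (1# , 0#)
    isCommutativeRing[√] = record
      { isRing = record
        { +-isAbelianGroup = AbelianGroup.isAbelianGroup +-pairs
        ; *-cong = λ { (p , q) (p′ , q′) →
            +-cong (*-cong p p′) (*-congˡ (*-cong q q′)) , +-cong (*-cong p q′) (*-cong q p′) }
        ; *-assoc = λ { (a , b) (a′ , b′) (a″ , b″) →
            solve 7 (λ d a b a′ b′ a″ b″ →
              (a :* a′ :+ d :* (b :* b′)) :* a″ :+ d :* ((a :* b′ :+ b :* a′) :* b″) :=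
              a :* (a′ :* a″ :+ d :* (b′ :* b″)) :+ d :* (b :* (a′ :* b″ :+ b′ :* a″)))
              refl d a b a′ b′ a″ b″ ,
            solve 7 (λ d a b a′ b′ a″ b″ →
              (a :* a′ :+ d :* (b :* b′)) :* b″ :+ (a :* b′ :+ b :* a′) :* a″ :=
              a :* (a′ :* b″ :+ b′ :* a″) :+ b :* (a′ :* a″ :+ d :* (b′ :* b″)))
              refl d a b a′ b′ a″ b″ }
        ; *-identity =
            (λ { (a , b) →
              solve 3 (λ d a b → con 1 :* a :+ d :* (con 0 :* b) := a) refl d a b ,
              solve 2 (λ a b → con 1 :* b :+ con 0 :* a := b) refl a b }) ,
            (λ { (a , b) →
              solve 3 (λ d a b → a :* con 1 :+ d :* (b :* con 0) := a) refl d a b ,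
              solve 2 (λ a b → a :* con 0 :+ b :* con 1 := b) refl a b })
        ; distrib =
            (λ { (a , b) (a′ , b′) (a″ , b″) →
              solve 7 (λ d a b a′ b′ a″ b″ →
                a :* (a′ :+ a″) :+ d :* (b :* (b′ :+ b″)) :=
                (a :* a′ :+ d :* (b :* b′)) :+ (a :* a″ :+ d :* (b :* b″)))
                refl d a b a′ b′ a″ b″ ,
              solve 6 (λ a b a′ b′ a″ b″ →
                a :* (b′ :+ b″) :+ b :* (a′ :+ a″) :=
                (a :* b′ :+ b :* a′) :+ (a :* b″ :+ b :* a″))
                refl a b a′ b′ a″ b″ }) ,
            (λ { (a , b) (a′ , b′) (a″ , b″) →
              solve 7 (λ d a b a′ b′ a″ b″ →
                (a′ :+ a″) :* a :+ d :* ((b′ :+ b″) :* b) :=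
                (a′ :* a :+ d :* (b′ :* b)) :+ (a″ :* a :+ d :* (b″ :* b)))
                refl d a b a′ b′ a″ b″ ,
              solve 6 (λ a b a′ b′ a″ b″ →
                (a′ :+ a″) :* b :+ (b′ :+ b″) :* a :=
                (a′ :* b :+ b′ :* a) :+ (a″ :* b :+ b″ :* a))
                refl a b a′ b′ a″ b″ })
        }
      ; *-comm = λ { (a , b) (a′ , b′) →
          solve 5 (λ d a b a′ b′ → a :* a′ :+ d :* (b :* b′) := a′ :* a :+ d :* (b′ :* b))
            refl d a b a′ b′ ,
          solve 4 (λ a b a′ b′ → a :* b′ :+ b :* a′ := a′ :* b :+ b′ :* a)
            refl a b a′ b′ }
      }

  ring[√] : CommutativeRing 0ℓ 0ℓ
  ring[√] = record
    { Carrier = Pair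
    ; _≈_ = AbelianGroup._≈_ +-pairs
    ; _+_ = AbelianGroup._∙_ +-pairs
    ; _*_ = _⊛_
    ; -_  = AbelianGroup._⁻¹ +-pairs
    ; 0#  = 0# , 0#
    ; 1#  = 1# , 0#
    ; isCommutativeRing = isCommutativeRing[√]
    }

  -- Written so that it is literally the first coordinate of (a , b) ⊛ (a , - b), the product with
  -- the conjugate.
  norm : Pair → Carrier
  norm (a , b) = a * a + d * (b * - b)

  open Relation.Binary.Reasoning.Setoid setoid

  norm≈0⇒a²≈db² : ∀ {a b} → norm (a , b) ≈ 0# → a * a ≈ d * (b * b)
  norm≈0⇒a²≈db² {a} {b} N≈0 = begin
    a * a                                    ≈⟨ +-identityʳ (a * a) ⟨
    -- The added zero is d b (-b + b). The solver works over a semiring and sees `- b` as an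
    -- independent variable, so the cancellation is supplied by hand.
    a * a + 0#                               ≈⟨ +-congˡ (trans (*-congˡ (trans (*-congˡ (-‿inverseˡ b)) (zeroʳ b))) (zeroʳ d)) ⟨
    a * a + d * (b * (- b + b))              ≈⟨ solve 4 (λ d a b -b → a :* a :+ d :* (b :* (-b :+ b)) := (a :* a :+ d :* (b :* -b)) :+ d :* (b :* b)) refl d a b (- b) ⟩
    (a * a + d * (b * - b)) + d * (b * b)    ≈⟨ +-congʳ N≈0 ⟩
    0# + d * (b * b)                         ≈⟨ +-identityˡ _ ⟩
    d * (b * b)                              ∎

  a²≈db²⇒norm≈0 : ∀ {a b} → a * a ≈ d * (b * b) → norm (a , b) ≈ 0#
  a²≈db²⇒norm≈0 {a} {b} a²≈db² = begin
    a * a + d * (b * - b)          ≈⟨ +-congʳ a²≈db² ⟩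
    d * (b * b) + d * (b * - b)    ≈⟨ solve 3 (λ d b -b → d :* (b :* b) :+ d :* (b :* -b) := d :* (b :* (b :+ -b))) refl d b (- b) ⟩
    d * (b * (b + - b))            ≈⟨ *-congˡ (trans (*-congˡ (-‿inverseʳ b)) (zeroʳ b)) ⟩
    d * 0#                         ≈⟨ zeroʳ d ⟩
    0#                             ∎

-- Bases obtained from dual coordinate functionals

module _ (M : CommutativeMonoid 0ℓ 0ℓ) where
  open CommutativeMonoid M
  open Algebra.Properties.CommutativeMonoid.Sum M using (sum; sum-cong-≋; sum-replicate-zero)

  sum-single : ∀ {n} (t : Vector Carrier n) i → (∀ j → ¬ (j ≡ i) → t j ≈ ε) → sum t ≈ t i
  sum-single {suc n} t zero vanish =
    trans (∙-congˡ (trans (sum-cong-≋ (λ j → vanish (suc j) λ ())) (sum-replicate-zero n)))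
          (identityʳ (t zero))
  sum-single {suc n} t (suc i) vanish =
    trans (∙-congʳ (vanish zero λ ()))
      (trans (identityˡ _) (sum-single (t ∘ suc) i λ j j≢i → vanish (suc j) (j≢i ∘ Fin.suc-injective)))

kronecker : (F : Field) {n : ℕ} → Fin n → Fin n → Field.Carrier F
kronecker F i j = if does (i Fin.≟ j) then 1# else 0#
  where open Field F

module _ {F : Field} (A : Algebra F) where
  private module F = Field F
  open Algebra A

  -- A dual-basis criterion: linear functionals that separate points and are dual to `e`. An element
  -- and the combination of `e` with its coordinates then have equal coordinates, so `e` spans;
  -- duality also recovers the coefficients of any combination.
  record IsCoordinateSystem {n : ℕ} (e : Vector Carrier n) (coord : Carrier → Vector F.Carrier n) : Set where
    field
      coord-cong      : ∀ {a b} → a ≈ b → ∀ i → coord a i F.≈ coord b i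
      coord-injective : ∀ {a b} → (∀ i → coord a i F.≈ coord b i) → a ≈ b
      coord-+         : ∀ a b i → coord (a + b) i F.≈ coord a i F.+ coord b i
      coord-*         : ∀ c a i → coord (algebraMap c * a) i F.≈ c F.* coord a i
      coord-basis     : ∀ j i → coord (e j) i F.≈ kronecker F i j

    coord-0 : ∀ i → coord 0# i F.≈ F.0#
    coord-0 i = F.trans (coord-cong (sym (zeroʳ (algebraMap F.0#))) i)
      (F.trans (coord-* F.0# 0# i) (F.zeroˡ (coord 0# i)))

    private
      open Algebra.Properties.Semiring.Sum F.semiring using (sum-cong-≋) renaming (sum to sumᶠ)

      coord-sum : ∀ {k} (t : Vector Carrier k) i → coord (sum t) i F.≈ sumᶠ (λ j → coord (t j) i)
      coord-sum {zero}  t i = coord-0 i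
      coord-sum {suc k} t i = F.trans (coord-+ _ _ i) (F.+-congˡ (coord-sum (t ∘ suc) i))

      coord-combination : ∀ (c : Vector F.Carrier n) i →
                          coord (sum (λ j → algebraMap (c j) * e j)) i F.≈ c i
      coord-combination c i = begin
        coord (sum (λ j → algebraMap (c j) * e j)) i     ≈⟨ coord-sum (λ j → algebraMap (c j) * e j) i ⟩
        sumᶠ (λ j → coord (algebraMap (c j) * e j) i)    ≈⟨ sum-cong-≋ (λ j → F.trans (coord-* (c j) (e j) i) (F.*-congˡ (coord-basis j i))) ⟩
        sumᶠ (λ j → c j F.* kronecker F i j)             ≈⟨ sum-single F.+-commutativeMonoid _ i off-diagonal ⟩
        c i F.* kronecker F i i                          ≡⟨ ≡.cong (λ b → c i F.* (if b then F.1# else F.0#)) (dec-true (i Fin.≟ i) ≡.refl) ⟩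
        c i F.* F.1#                                     ≈⟨ F.*-identityʳ (c i) ⟩
        c i                                              ∎
        where
        open Relation.Binary.Reasoning.Setoid F.setoid
        off-diagonal : ∀ j → ¬ (j ≡ i) → c j F.* kronecker F i j F.≈ F.0#
        off-diagonal j j≢i rewrite dec-false (i Fin.≟ j) (j≢i ∘ ≡.sym) = F.zeroʳ (c j)

    hasDimension : HasDimension A n
    hasDimension = e , λ a → coord a ,
      coord-injective (coord-combination (coord a)) ,
      λ {c} c-coords i → F.trans (F.sym (coord-cong c-coords i)) (coord-combination c i)

-- A division-free way to say that d has no square root; it is what makes the norm form a² - d b²
-- anisotropic.
NonSquare : (F : DiscreteField) → DiscreteField.Carrier F → Set
NonSquare F d = ∀ a b → a * a ≈ d * (b * b) → b ≈ 0#
  where open DiscreteField F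

-- The field F(√d), its conjugation, and homomorphisms out of it

module QuadraticField
  (F : DiscreteField) (d : DiscreteField.Carrier F) (nonsquare : NonSquare F d)
  where

  open DiscreteField F
  open QuadraticRing commutativeRing d public
  open Algebra.Solver.Ring.NaturalCoefficients.Default commutativeSemiring

  private
    module R = CommutativeRing ring[√]

    norm≉0 : ∀ {a b} → ¬ ((a , b) R.≈ R.0#) → ¬ (norm (a , b) ≈ 0#)
    norm≉0 {a} {b} x≉0 N≈0 with a ≟ 0#
    ... | yes a≈0 = x≉0 (a≈0 , nonsquare a b (norm≈0⇒a²≈db² N≈0))
    ... | no  a≉0 = a≉0 (x*y≈0⇒y≈0 a≉0 (trans (norm≈0⇒a²≈db² N≈0)
      (trans (*-congˡ (trans (*-congˡ (nonsquare a b (norm≈0⇒a²≈db² N≈0))) (zeroʳ b))) (zeroʳ d))))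

  abstract
    inverse[√] : ∀ x → ¬ (x R.≈ R.0#) → ∃[ y ] y R.* x R.≈ R.1#
    inverse[√] x@(a , b) x≉0 =
      let n , nN≈1 = inverse _ (norm≉0 x≉0) in
      (n * a , n * - b) ,
      trans (solve 5 (λ d a b -b n → n :* a :* a :+ d :* (n :* -b :* b) := n :* (a :* a :+ d :* (b :* -b))) refl d a b (- b) n) nN≈1 ,
      trans (solve 4 (λ a b -b n → n :* a :* b :+ n :* -b :* a := n :* a :* (b :+ -b)) refl a b (- b) n)
        (trans (*-congˡ (-‿inverseʳ b)) (zeroʳ _))

  field[√] : DiscreteField
  field[√] = record
    { commutativeRing = ring[√]
    ; _≟_ = ×-decidable _≟_ _≟_
    ; 1≉0 = 1≉0 ∘ proj₁
    ; inverse = inverse[√]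
    }

  √d : R.Carrier
  √d = 0# , 1#

  √d²≈d : √d R.* √d R.≈ (d , 0#)
  √d²≈d = solve 1 (λ d → con 0 :* con 0 :+ d :* (con 1 :* con 1) := d) refl d ,
          solve 0 (con 0 :* con 1 :+ con 1 :* con 0 := con 0) refl

  ι : Carrier → R.Carrier
  ι a = a , 0#

  ι-isRingHomomorphism : Hom.IsRingHomomorphism ring R.ring ι
  ι-isRingHomomorphism = Hom.mkHom ring R.ring
    (λ p → p , refl)
    (λ a a′ → refl , sym (+-identityˡ 0#))
    (λ a a′ → solve 3 (λ d a a′ → a :* a′ := a :* a′ :+ d :* (con 0 :* con 0)) refl d a a′ ,
              solve 2 (λ a a′ → con 0 := a :* con 0 :+ con 0 :* a′) refl a a′)
    R.refl

  extension : Extension field′ (DiscreteField.field′ field[√])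
  extension = record { embed = ι ; isRingHomomorphism = ι-isRingHomomorphism }

  ι-* : ∀ c x → ι c R.* x R.≈ (c * proj₁ x , c * proj₂ x)
  ι-* c (a , b) =
    solve 4 (λ d c a b → c :* a :+ d :* (con 0 :* b) := c :* a) refl d c a b ,
    solve 3 (λ c a b → c :* b :+ con 0 :* a := c :* b) refl c a b

  a+b√d : ∀ x → x R.≈ ι (proj₁ x) R.+ ι (proj₂ x) R.* √d
  a+b√d (a , b) = R.sym (R.trans (R.+-congˡ (ι-* b √d))
    ( solve 2 (λ a b → a :+ b :* con 0 := a) refl a b
    , solve 1 (λ b → con 0 :+ b :* con 1 := b) refl b ))

  hasDegree-2 : HasDegree extension 2
  hasDegree-2 = IsCoordinateSystem.hasDimension {A = extensionAlgebra extension} {e = e} {coord = coord} record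
    { coord-cong      = λ { (p , q) 0F → p ; (p , q) 1F → q }
    ; coord-injective = λ p → p 0F , p 1F
    ; coord-+         = λ { a b 0F → refl ; a b 1F → refl }
    ; coord-*         = λ { c a 0F → proj₁ (ι-* c a) ; c a 1F → proj₂ (ι-* c a) }
    ; coord-basis     = λ { 0F 0F → refl ; 0F 1F → refl ; 1F 0F → refl ; 1F 1F → refl }
    }
    where
    e : Vector R.Carrier 2
    e 0F = R.1#
    e 1F = √d
    coord : R.Carrier → Vector Carrier 2
    coord (a , b) 0F = a
    coord (a , b) 1F = b

  -- The semilinear map a + b √d ↦ θ a + θ b ε √d; here ε √d is a square root of θ d.
  module Twist
    (θ : Carrier → Carrier) (θ-hom : Hom.IsRingHomomorphism ring ring θ)
    (ε : Carrier) (θd≈dε² : θ d ≈ d * (ε * ε))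
    where
    private module θ = Hom.IsRingHomomorphism ring ring θ-hom

    twist : R.Carrier → R.Carrier
    twist (a , b) = θ a , θ b * ε

    twist-isRingHomomorphism : Hom.IsRingHomomorphism R.ring R.ring twist
    twist-isRingHomomorphism = Hom.mkHom R.ring R.ring
      (λ (p , q) → θ.⟦⟧-cong p , *-congʳ (θ.⟦⟧-cong q))
      (λ (a , b) (a′ , b′) → θ.+-homo a a′ , trans (*-congʳ (θ.+-homo b b′)) (distribʳ ε (θ b) (θ b′)))
      (λ (a , b) (a′ , b′) →
        (begin
          θ (a * a′ + d * (b * b′))                   ≈⟨ θ.+-homo (a * a′) (d * (b * b′)) ⟩
          θ (a * a′) + θ (d * (b * b′))               ≈⟨ +-cong (θ.*-homo a a′) (trans (θ.*-homo d (b * b′)) (*-cong θd≈dε² (θ.*-homo b b′))) ⟩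
          θ a * θ a′ + d * (ε * ε) * (θ b * θ b′)     ≈⟨ solve 6 (λ d ε a b a′ b′ → a :* a′ :+ d :* (ε :* ε) :* (b :* b′) := a :* a′ :+ d :* (b :* ε :* (b′ :* ε))) refl d ε (θ a) (θ b) (θ a′) (θ b′) ⟩
          θ a * θ a′ + d * (θ b * ε * (θ b′ * ε))     ∎) ,
        (begin
          θ (a * b′ + b * a′) * ε                     ≈⟨ *-congʳ (trans (θ.+-homo (a * b′) (b * a′)) (+-cong (θ.*-homo a b′) (θ.*-homo b a′))) ⟩
          (θ a * θ b′ + θ b * θ a′) * ε               ≈⟨ solve 5 (λ ε a b a′ b′ → (a :* b′ :+ b :* a′) :* ε := a :* (b′ :* ε) :+ b :* ε :* a′) refl ε (θ a) (θ b) (θ a′) (θ b′) ⟩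
          θ a * (θ b′ * ε) + θ b * ε * θ a′           ∎))
      (θ.1#-homo , trans (*-congʳ θ.0#-homo) (zeroˡ ε))
      where open Relation.Binary.Reasoning.Setoid setoid

  module _ (S : Ring 0ℓ 0ℓ) where
    private module S = Ring S

    -- The target may be noncommutative, since this is applied to maps into M₂(ℍ) as well as to maps
    -- between fields.
    hom-unique : {f g : R.Carrier → S.Carrier} →
                 Hom.IsRingHomomorphism R.ring S f → Hom.IsRingHomomorphism R.ring S g →
                 (∀ a → f (ι a) S.≈ g (ι a)) → f √d S.≈ g √d → ∀ x → f x S.≈ g x
    hom-unique {f} {g} f-hom g-hom f≈g-ι f≈g-√d x@(a , b) = begin
      f x                              ≈⟨ f.⟦⟧-cong (a+b√d x) ⟩
      f (ι a R.+ ι b R.* √d)           ≈⟨ S.trans (f.+-homo _ _) (S.+-congˡ (f.*-homo _ _)) ⟩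
      f (ι a) S.+ f (ι b) S.* f √d     ≈⟨ S.+-cong (f≈g-ι a) (S.*-cong (f≈g-ι b) f≈g-√d) ⟩
      g (ι a) S.+ g (ι b) S.* g √d     ≈⟨ S.trans (g.+-homo _ _) (S.+-congˡ (g.*-homo _ _)) ⟨
      g (ι a R.+ ι b R.* √d)           ≈⟨ g.⟦⟧-cong (a+b√d x) ⟨
      g x                              ∎
      where
      open Relation.Binary.Reasoning.Setoid S.setoid
      module f = Hom.IsRingHomomorphism R.ring S f-hom
      module g = Hom.IsRingHomomorphism R.ring S g-hom

    -- The universal property of F(√d) for noncommutative targets: √d may be sent to any square root
    -- of φ d that commutes with the image of φ.
    module Lift
      {φ : Carrier → S.Carrier} (φ-hom : Hom.IsRingHomomorphism ring S φ)
      (s : S.Carrier) (s²≈φd : s S.* s S.≈ φ d) (sφ≈φs : ∀ a → s S.* φ a S.≈ φ a S.* s)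
      where
      private module φ = Hom.IsRingHomomorphism ring S φ-hom

      lift : R.Carrier → S.Carrier
      lift (a , b) = φ a S.+ φ b S.* s

      lift-ι : ∀ a → lift (ι a) S.≈ φ a
      lift-ι a = S.trans (S.+-congˡ (S.trans (S.*-congʳ φ.0#-homo) (S.zeroˡ s))) (S.+-identityʳ (φ a))

      lift-√d : lift √d S.≈ s
      lift-√d = S.trans (S.+-cong φ.0#-homo (S.trans (S.*-congʳ φ.1#-homo) (S.*-identityˡ s))) (S.+-identityˡ s)

      -- Commuting with φ and s suffices to commute with the whole image. This supplies the
      -- commutation hypothesis for a second lift, one step further up a tower.
      lift-commutes : ∀ t → (∀ a → t S.* φ a S.≈ φ a S.* t) → t S.* s S.≈ s S.* t →
                      ∀ x → t S.* lift x S.≈ lift x S.* t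
      lift-commutes t tφ≈φt ts≈st (a , b) = begin
        t S.* (φ a S.+ φ b S.* s)            ≈⟨ S.distribˡ t (φ a) (φ b S.* s) ⟩
        t S.* φ a S.+ t S.* (φ b S.* s)      ≈⟨ S.+-cong (tφ≈φt a) (S.sym (S.*-assoc t (φ b) s)) ⟩
        φ a S.* t S.+ t S.* φ b S.* s        ≈⟨ S.+-congˡ (S.trans (S.*-congʳ (tφ≈φt b)) (S.*-assoc (φ b) t s)) ⟩
        φ a S.* t S.+ φ b S.* (t S.* s)      ≈⟨ S.+-congˡ (S.trans (S.*-congˡ ts≈st) (S.sym (S.*-assoc (φ b) s t))) ⟩
        φ a S.* t S.+ φ b S.* s S.* t        ≈⟨ S.distribʳ t (φ a) (φ b S.* s) ⟨
        (φ a S.+ φ b S.* s) S.* t            ∎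
        where open Relation.Binary.Reasoning.Setoid S.setoid

      lift-isRingHomomorphism : Hom.IsRingHomomorphism R.ring S lift
      lift-isRingHomomorphism = Hom.mkHom R.ring S
        (λ (p , q) → S.+-cong (φ.⟦⟧-cong p) (S.*-congʳ (φ.⟦⟧-cong q)))
        (λ (a , b) (a′ , b′) → begin
          φ (a + a′) S.+ φ (b + b′) S.* s                          ≈⟨ S.+-cong (φ.+-homo a a′) (S.trans (S.*-congʳ (φ.+-homo b b′)) (S.distribʳ s (φ b) (φ b′))) ⟩
          (φ a S.+ φ a′) S.+ (φ b S.* s S.+ φ b′ S.* s)            ≈⟨ interchange (φ a) (φ a′) _ _ ⟩
          (φ a S.+ φ b S.* s) S.+ (φ a′ S.+ φ b′ S.* s)            ∎)
        (λ (a , b) (a′ , b′) → begin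
          φ (a * a′ + d * (b * b′)) S.+ φ (a * b′ + b * a′) S.* s
            ≈⟨ S.+-cong (S.trans (φ.+-homo _ _) (S.+-cong (φ.*-homo a a′) (rotate b b′)))
                        (S.trans (S.*-congʳ (φ.+-homo _ _)) (S.trans (S.distribʳ s _ _)
                          (S.+-cong (S.trans (S.*-congʳ (φ.*-homo a b′)) (S.*-assoc _ _ _)) (slide b a′)))) ⟩
          (φ a S.* φ a′ S.+ φ b S.* s S.* (φ b′ S.* s)) S.+ (φ a S.* (φ b′ S.* s) S.+ φ b S.* s S.* φ a′)
            ≈⟨ swap _ _ _ _ ⟩
          (φ a S.* φ a′ S.+ φ a S.* (φ b′ S.* s)) S.+ (φ b S.* s S.* φ a′ S.+ φ b S.* s S.* (φ b′ S.* s))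
            ≈⟨ S.+-cong (S.distribˡ (φ a) _ _) (S.distribˡ (φ b S.* s) _ _) ⟨
          φ a S.* (φ a′ S.+ φ b′ S.* s) S.+ φ b S.* s S.* (φ a′ S.+ φ b′ S.* s)
            ≈⟨ S.distribʳ _ _ _ ⟨
          (φ a S.+ φ b S.* s) S.* (φ a′ S.+ φ b′ S.* s) ∎)
        (S.trans (lift-ι 1#) φ.1#-homo)
        where
        open Relation.Binary.Reasoning.Setoid S.setoid
        open Algebra.Properties.CommutativeSemigroup (CommutativeMonoid.commutativeSemigroup S.+-commutativeMonoid)
          using (interchange)
        slide : ∀ b a′ → φ (b * a′) S.* s S.≈ φ b S.* s S.* φ a′
        slide b a′ = begin
          φ (b * a′) S.* s          ≈⟨ S.*-congʳ (φ.*-homo b a′) ⟩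
          φ b S.* φ a′ S.* s        ≈⟨ S.*-assoc _ _ _ ⟩
          φ b S.* (φ a′ S.* s)      ≈⟨ S.*-congˡ (sφ≈φs a′) ⟨
          φ b S.* (s S.* φ a′)      ≈⟨ S.*-assoc _ _ _ ⟨
          φ b S.* s S.* φ a′        ∎
        rotate : ∀ b b′ → φ (d * (b * b′)) S.≈ φ b S.* s S.* (φ b′ S.* s)
        rotate b b′ = begin
          φ (d * (b * b′))                ≈⟨ φ.⟦⟧-cong (*-comm d (b * b′)) ⟩
          φ (b * b′ * d)                  ≈⟨ φ.*-homo _ d ⟩
          φ (b * b′) S.* φ d              ≈⟨ S.*-congˡ s²≈φd ⟨
          φ (b * b′) S.* (s S.* s)        ≈⟨ S.*-assoc _ _ _ ⟨
          φ (b * b′) S.* s S.* s          ≈⟨ S.*-congʳ (slide b b′) ⟩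
          φ b S.* s S.* φ b′ S.* s        ≈⟨ S.*-assoc _ _ _ ⟩
          φ b S.* s S.* (φ b′ S.* s)      ∎
        swap : ∀ w x y z → (w S.+ x) S.+ (y S.+ z) S.≈ (w S.+ y) S.+ (z S.+ x)
        swap w x y z = S.trans (interchange w x y z) (S.+-congˡ (S.+-comm x z))

  private
    1≈-1*-1 : 1# ≈ - 1# * - 1#
    1≈-1*-1 = sym (trans (-1*x≈-x (- 1#)) (⁻¹-involutive 1#))
      where
      open Algebra.Properties.Ring ring using (-1*x≈-x)
      open Algebra.Properties.Group +-group using (⁻¹-involutive)

  open Twist id (Identity.isRingHomomorphism (Ring.rawRing ring) refl) (- 1#)
    (trans (sym (*-identityʳ d)) (*-congˡ 1≈-1*-1)) public
    renaming (twist to conj; twist-isRingHomomorphism to conj-isRingHomomorphism)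

  -- Twisting by -1 gives `b * - 1#` in the second coordinate; `norm` is phrased with `- b`.
  conj≈[a,-b] : ∀ x → conj x R.≈ (proj₁ x , - proj₂ x)
  conj≈[a,-b] (a , b) = refl , trans (*-comm b (- 1#)) (-1*x≈-x b)
    where open Algebra.Properties.Ring ring using (-1*x≈-x)

  conj-involutive : ∀ x → conj (conj x) R.≈ x
  conj-involutive (a , b) = refl ,
    trans (*-assoc b (- 1#) (- 1#)) (trans (*-congˡ (sym 1≈-1*-1)) (*-identityʳ b))

  conj-√d : conj √d R.≈ R.- √d
  conj-√d = sym -0#≈0# , *-identityˡ (- 1#)
    where open Algebra.Properties.Ring ring using (-0#≈0#)

  module _ (S : DiscreteField) where
    private module S = DiscreteField S

    -- Both images of √d are square roots of the same element of a field, hence equal up to sign,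
    -- and `conj` absorbs the sign. Galois groups are computed by applying this to each quadratic
    -- step.
    hom-dichotomy : {f g : R.Carrier → S.Carrier} →
                    Hom.IsRingHomomorphism R.ring S.ring f → Hom.IsRingHomomorphism R.ring S.ring g →
                    (∀ a → f (ι a) S.≈ g (ι a)) →
                    (∀ x → f x S.≈ g x) ⊎ (∀ x → f x S.≈ g (conj x))
    hom-dichotomy {f} {g} f-hom g-hom f≈g-ι with S.x²≈y²⇒x≈±y {f √d} {g √d} (begin
      f √d S.* f √d    ≈⟨ f.*-homo √d √d ⟨
      f (√d R.* √d)    ≈⟨ f.⟦⟧-cong √d²≈d ⟩
      f (ι d)          ≈⟨ f≈g-ι d ⟩
      g (ι d)          ≈⟨ g.⟦⟧-cong √d²≈d ⟨
      g (√d R.* √d)    ≈⟨ g.*-homo √d √d ⟩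
      g √d S.* g √d    ∎)
      where
      open Relation.Binary.Reasoning.Setoid S.setoid
      module f = Hom.IsRingHomomorphism R.ring S.ring f-hom
      module g = Hom.IsRingHomomorphism R.ring S.ring g-hom
    ... | inj₁ f√d≈g√d  = inj₁ (hom-unique S.ring f-hom g-hom f≈g-ι f√d≈g√d)
    ... | inj₂ f√d≈-g√d = inj₂ (hom-unique S.ring f-hom
      (Composition.isRingHomomorphism S.trans conj-isRingHomomorphism g-hom)
      (λ a → S.trans (f≈g-ι a) (g.⟦⟧-cong (refl , sym (zeroˡ (- 1#)))))
      (S.trans f√d≈-g√d (S.trans (S.sym (g.-‿homo √d)) (g.⟦⟧-cong (R.sym conj-√d)))))
      where module g = Hom.IsRingHomomorphism R.ring S.ring g-hom

-- Matrix algebras over an algebra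

module MatrixAlgebra {F : Field} (D : Algebra F) (s : ℕ) where
  private
    module F = Field F
    module M = RawRing (matrixRing s D)
  open Algebra D
  private module ι = RingMorphisms.IsRingHomomorphism isRingHomomorphism
  open Algebra.Properties.Semiring.Sum semiring
    using (sum-cong-≋; ∑-distrib-+; ∑-comm; *-distribˡ-sum; *-distribʳ-sum)
  open Relation.Binary.Reasoning.Setoid setoid

  diagonal-≡ : ∀ a i → diagonal D s a i i ≈ a
  diagonal-≡ a i rewrite dec-true (i Fin.≟ i) ≡.refl = refl

  diagonal-≢ : ∀ a {i j} → ¬ (i ≡ j) → diagonal D s a i j ≈ 0#
  diagonal-≢ a {i} {j} i≢j rewrite dec-false (i Fin.≟ j) i≢j = refl

  diagonal-*ˡ : ∀ a x i j → (diagonal D s a M.* x) i j ≈ a * x i j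
  diagonal-*ˡ a x i j = begin
    sum (λ k → diagonal D s a i k * x k j)    ≈⟨ sum-single +-commutativeMonoid _ i (λ k k≢i → trans (*-congʳ (diagonal-≢ a (k≢i ∘ ≡.sym))) (zeroˡ _)) ⟩
    diagonal D s a i i * x i j                ≈⟨ *-congʳ (diagonal-≡ a i) ⟩
    a * x i j                                 ∎

  diagonal-*ʳ : ∀ x a i j → (x M.* diagonal D s a) i j ≈ x i j * a
  diagonal-*ʳ x a i j = begin
    sum (λ k → x i k * diagonal D s a k j)    ≈⟨ sum-single +-commutativeMonoid _ j (λ k k≢j → trans (*-congˡ (diagonal-≢ a k≢j)) (zeroʳ _)) ⟩
    x i j * diagonal D s a j j                ≈⟨ *-congˡ (diagonal-≡ a j) ⟩
    x i j * a                                 ∎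

  diagonal-elim : ∀ a x → (∀ i → a ≈ x i i) → (∀ i j → ¬ (i ≡ j) → 0# ≈ x i j) → diagonal D s a M.≈ x
  diagonal-elim a x on off i j with i Fin.≟ j
  ... | yes ≡.refl = on i
  ... | no  i≢j    = off i j i≢j

  abstract
    isMatrixRing : IsRing M._≈_ M._+_ M._*_ M.-_ M.0# M.1#
    isMatrixRing = record
      { +-isAbelianGroup = record
        { isGroup = record
          { isMonoid = record
            { isSemigroup = record
              { isMagma = record
                { isEquivalence = record
                  { refl = λ i j → refl
                  ; sym = λ p i j → sym (p i j)
                  ; trans = λ p q i j → trans (p i j) (q i j)
                  }
                ; ∙-cong = λ p q i j → +-cong (p i j) (q i j)
                }
              ; assoc = λ x y z i j → +-assoc (x i j) (y i j) (z i j)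
              }
            ; identity = (λ x i j → +-identityˡ (x i j)) , (λ x i j → +-identityʳ (x i j))
            }
          ; inverse = (λ x i j → -‿inverseˡ (x i j)) , (λ x i j → -‿inverseʳ (x i j))
          ; ⁻¹-cong = λ p i j → -‿cong (p i j)
          }
        ; comm = λ x y i j → +-comm (x i j) (y i j)
        }
      ; *-cong = λ p q i j → sum-cong-≋ (λ k → *-cong (p i k) (q k j))
      ; *-assoc = λ x y z i j → begin
          sum (λ k → sum (λ l → x i l * y l k) * z k j)      ≈⟨ sum-cong-≋ (λ k → *-distribʳ-sum (z k j) (λ l → x i l * y l k)) ⟩
          sum (λ k → sum (λ l → x i l * y l k * z k j))      ≈⟨ ∑-comm (λ k l → x i l * y l k * z k j) ⟩
          sum (λ l → sum (λ k → x i l * y l k * z k j))      ≈⟨ sum-cong-≋ (λ l → sum-cong-≋ (λ k → *-assoc (x i l) (y l k) (z k j))) ⟩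
          sum (λ l → sum (λ k → x i l * (y l k * z k j)))    ≈⟨ sum-cong-≋ (λ l → *-distribˡ-sum (x i l) (λ k → y l k * z k j)) ⟨
          sum (λ l → x i l * sum (λ k → y l k * z k j))      ∎
      ; *-identity =
          (λ x i j → trans (diagonal-*ˡ 1# x i j) (*-identityˡ (x i j))) ,
          (λ x i j → trans (diagonal-*ʳ x 1# i j) (*-identityʳ (x i j)))
      ; distrib =
          (λ x y z i j → trans (sum-cong-≋ (λ k → distribˡ (x i k) (y k j) (z k j)))
            (∑-distrib-+ (λ k → x i k * y k j) (λ k → x i k * z k j))) ,
          (λ x y z i j → trans (sum-cong-≋ (λ k → distribʳ (x k j) (y i k) (z i k)))
            (∑-distrib-+ (λ k → y i k * x k j) (λ k → z i k * x k j)))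
      }

  private
    matrices : Ring _ _
    matrices = record { isRing = isMatrixRing }
    module R = Ring matrices

  matrixAlgebra : Algebra F
  matrixAlgebra = record
    { ring = matrices
    ; algebraMap = diagonal D s ∘ algebraMap
    ; isRingHomomorphism = Hom.mkHom F.ring matrices
        (λ {c} {c′} c≈c′ → diagonal-elim _ _
          (λ i → trans (ι.⟦⟧-cong c≈c′) (sym (diagonal-≡ _ i))) (λ i j i≢j → sym (diagonal-≢ _ i≢j)))
        (λ c c′ → diagonal-elim _ _
          (λ i → trans (ι.+-homo c c′) (sym (+-cong (diagonal-≡ _ i) (diagonal-≡ _ i))))
          (λ i j i≢j → trans (sym (+-identityˡ 0#)) (sym (+-cong (diagonal-≢ _ i≢j) (diagonal-≢ _ i≢j)))))
        (λ c c′ → diagonal-elim _ _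
          (λ i → trans (ι.*-homo c c′) (sym (trans (diagonal-*ˡ _ (diagonal D s (algebraMap c′)) i i) (*-congˡ (diagonal-≡ _ i)))))
          (λ i j i≢j → sym (trans (diagonal-*ˡ _ (diagonal D s (algebraMap c′)) i j) (trans (*-congˡ (diagonal-≢ _ i≢j)) (zeroʳ _)))))
        (diagonal-elim _ _ (λ i → trans ι.1#-homo (sym (diagonal-≡ _ i))) (λ i j i≢j → sym (diagonal-≢ _ i≢j)))
    ; central = λ c x i j →
        trans (diagonal-*ˡ (algebraMap c) x i j) (trans (central c (x i j)) (sym (diagonal-*ʳ x (algebraMap c) i j)))
    }

  isMatrixAlgebra : IsMatrixAlgebra matrixAlgebra s D
  isMatrixAlgebra = record
    { to = id
    ; isRingIsomorphism = Identity.isRingIsomorphism (matrixRing s D) R.refl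
    ; to-algebraMap = λ c → R.refl
    }

-- Conjugation by a unit

module InnerAutomorphism (S : Ring 0ℓ 0ℓ) (u u⁻¹ : Ring.Carrier S)
  (inverseʳ : Ring._≈_ S (Ring._*_ S u u⁻¹) (Ring.1# S)) (inverseˡ : Ring._≈_ S (Ring._*_ S u⁻¹ u) (Ring.1# S))
  where
  open Ring S

  inner : Carrier → Carrier
  inner x = u⁻¹ * x * u

  inner-isRingHomomorphism : Hom.IsRingHomomorphism S S inner
  inner-isRingHomomorphism = Hom.mkHom S S
    (λ p → *-congʳ (*-congˡ p))
    (λ x y → trans (*-congʳ (distribˡ u⁻¹ x y)) (distribʳ u (u⁻¹ * x) (u⁻¹ * y)))
    (λ x y → begin
      u⁻¹ * (x * y) * u                    ≈⟨ *-congʳ (*-assoc u⁻¹ x y) ⟨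
      u⁻¹ * x * y * u                      ≈⟨ *-congʳ (*-congʳ (*-identityʳ (u⁻¹ * x))) ⟨
      u⁻¹ * x * 1# * y * u                 ≈⟨ *-congʳ (*-congʳ (*-congˡ inverseʳ)) ⟨
      u⁻¹ * x * (u * u⁻¹) * y * u          ≈⟨ *-congʳ (*-congʳ (*-assoc (u⁻¹ * x) u u⁻¹)) ⟨
      u⁻¹ * x * u * u⁻¹ * y * u            ≈⟨ *-congʳ (*-assoc (u⁻¹ * x * u) u⁻¹ y) ⟩
      u⁻¹ * x * u * (u⁻¹ * y) * u          ≈⟨ *-assoc (u⁻¹ * x * u) (u⁻¹ * y) u ⟩
      u⁻¹ * x * u * (u⁻¹ * y * u)          ∎)
    (trans (*-congʳ (*-identityʳ u⁻¹)) inverseˡ)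
    where open Relation.Binary.Reasoning.Setoid setoid

  inner-commuting : ∀ {x} → x * u ≈ u * x → inner x ≈ x
  inner-commuting {x} xu≈ux = begin
    u⁻¹ * x * u      ≈⟨ *-assoc u⁻¹ x u ⟩
    u⁻¹ * (x * u)    ≈⟨ *-congˡ xu≈ux ⟩
    u⁻¹ * (u * x)    ≈⟨ *-assoc u⁻¹ u x ⟨
    u⁻¹ * u * x      ≈⟨ *-congʳ inverseˡ ⟩
    1# * x           ≈⟨ *-identityˡ x ⟩
    x                ∎
    where open Relation.Binary.Reasoning.Setoid setoid

open ≡ using (refl; sym; trans; cong; subst; subst₂; module ≡-Reasoning)

-- Extensions, Galois groups and norms

identityExtension : (F : Field) → Extension F F
identityExtension F = record
  { embed = id
  ; isRingHomomorphism = Identity.isRingHomomorphism rawRing (λ {x} → refl′ {x})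
  }
  where open Field F renaming (refl to refl′)

_∘ᴱ_ : {F E K : Field} → Extension E K → Extension F E → Extension F K
_∘ᴱ_ {K = K} K/E E/F = record
  { embed = Extension.embed K/E ∘ Extension.embed E/F
  ; isRingHomomorphism = Composition.isRingHomomorphism (Field.trans K)
      (Extension.isRingHomomorphism E/F) (Extension.isRingHomomorphism K/E)
  }

module _ {F K : Field} (K/F : Extension F K) where
  private
    module F = Field F
    module K = Field K
  open Extension K/F using (embed)
  open RingMorphisms K.rawRing K.rawRing

  homomorphism : (τ : Gal K/F) → IsRingHomomorphism (apply τ)
  homomorphism τ = IsRingIsomorphism.isRingHomomorphism (Gal.isRingIsomorphism τ)

  idᴳ : Gal K/F
  idᴳ = record
    { apply = id
    ; isRingIsomorphism = Identity.isRingIsomorphism K.rawRing K.refl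
    ; fixesBase = λ _ → K.refl
    }

  -- The new factor σ is applied first, matching the recursion of `iterate`.
  powerᴳ : Gal K/F → ℕ → Gal K/F
  powerᴳ σ zero    = idᴳ
  powerᴳ σ (suc k) = record
    { apply = apply (powerᴳ σ k) ∘ apply σ
    ; isRingIsomorphism = Composition.isRingIsomorphism K.trans
        (Gal.isRingIsomorphism σ) (Gal.isRingIsomorphism (powerᴳ σ k))
    ; fixesBase = λ c → K.trans
        (IsRingHomomorphism.⟦⟧-cong (homomorphism (powerᴳ σ k)) (Gal.fixesBase σ c))
        (Gal.fixesBase (powerᴳ σ k) c)
    }

  apply-powerᴳ : ∀ σ k x → apply (powerᴳ σ k) x ≡ iterate (apply σ) x k
  apply-powerᴳ σ zero    x = refl
  apply-powerᴳ σ (suc k) x = apply-powerᴳ σ k (apply σ x)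

  -- `IsNorm` comes with an enumeration of its own. Two enumerations of the same group differ by a
  -- permutation, which leaves a commutative product unchanged, so every norm can be evaluated on
  -- one fixed enumeration.
  norm-as-product : ∀ {r} (ρ : Vector (Gal K/F) r) → Bijective _≡_ (_≈ᴳ_ K/F) ρ →
                    ∀ {x b} → IsNorm K/F x b → embed b K.≈ K.product (λ i → apply (ρ i) x)
  norm-as-product {r} ρ (ρ-inj , ρ-surj) {x} (k , τ , (τ-inj , τ-surj) , b≈∏) =
    K.trans b≈∏ (K.trans (sum-permute (λ i → apply (τ i) x) π) (sum-cong-≋ λ i → τ∘to≈ρ i x))
    where
    open Algebra.Properties.CommutativeMonoid.Sum K.*-commutativeMonoid using (sum-permute; sum-cong-≋)
    to : Fin r → Fin k
    to i = proj₁ (τ-surj (ρ i))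
    from : Fin k → Fin r
    from i = proj₁ (ρ-surj (τ i))
    τ∘to≈ρ : ∀ i x → apply (τ (to i)) x K.≈ apply (ρ i) x
    τ∘to≈ρ i = proj₂ (τ-surj (ρ i)) refl
    ρ∘from≈τ : ∀ i x → apply (ρ (from i)) x K.≈ apply (τ i) x
    ρ∘from≈τ i = proj₂ (ρ-surj (τ i)) refl
    π : Permutation r k
    π = permutation to from
      (λ i → τ-inj λ x → K.trans (τ∘to≈ρ (from i) x) (ρ∘from≈τ i x))
      (λ i → ρ-inj λ x → K.trans (ρ∘from≈τ (to i) x) (τ∘to≈ρ i x))

hasDegree-1 : (F : Field) → HasDegree (identityExtension F) 1
hasDegree-1 F = IsCoordinateSystem.hasDimension {A = extensionAlgebra (identityExtension F)}
  {n = 1} {e = λ _ → 1#} {coord = λ x _ → x} record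
  { coord-cong      = λ p _ → p
  ; coord-injective = λ p → p 0F
  ; coord-+         = λ _ _ _ → refl′
  ; coord-*         = λ _ _ _ → refl′
  ; coord-basis     = λ { 0F 0F → refl′ }
  }
  where open Field F renaming (refl to refl′)

-- The cyclic quartic field K = ℚ(√-(2+√2)) over ℚ

abstract
  ℚ-inverse : ∀ x → ¬ (x ≡ 0ℚ) → ∃[ y ] y ℚ.* x ≡ 1ℚ
  ℚ-inverse x x≢0 = let instance _ = ≢-nonZero x≢0 in 1/ x , ℚ.*-inverseˡ x

  ℚ-isCommutativeRing : IsCommutativeRing _≡_ ℚ._+_ ℚ._*_ ℚ.-_ 0ℚ 1ℚ
  ℚ-isCommutativeRing = ℚ.+-*-isCommutativeRing

ℚ-field : DiscreteField
ℚ-field = record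
  { commutativeRing = record { isCommutativeRing = ℚ-isCommutativeRing }
  ; _≟_ = ℚ._≟_
  ; 1≉0 = λ ()
  ; inverse = ℚ-inverse
  }

-- Irrationality of √2 and sums of rational squares

2-prime : Prime 2
2-prime = from-yes (prime? 2)

2ℚ : ℚ
2ℚ = + 2 ℚ./ 1

module _ where
  open Data.Nat.Solver.+-*-Solver

  m²≢2n² : ∀ m n → Coprime m n → ¬ (m ℕ.* m ≡ 2 ℕ.* (n ℕ.* n))
  m²≢2n² m n coprime m²≡2n² = contradiction (coprime (2∣m , 2∣n)) λ ()
    where
    2∣m : 2 ∣ m
    2∣m = reduce (euclidsLemma m m 2-prime (subst (2 ∣_) (sym m²≡2n²) (m∣m*n (n ℕ.* n))))
    2∣n : 2 ∣ n
    2∣n with divides k refl ← 2∣m = reduce (euclidsLemma n n 2-prime (divides (k ℕ.* k)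
      (ℕ.*-cancelˡ-≡ (n ℕ.* n) (k ℕ.* k ℕ.* 2) 2
        (trans (sym m²≡2n²) (solve 1 (λ k → k :* con 2 :* (k :* con 2) := con 2 :* (k :* k :* con 2)) refl k)))))

-- A rational number is stored in lowest terms, so its numerator and denominator are already the
-- coprime pair that `m²≢2n²` needs.
p²≢2 : ∀ p → ¬ (p ℚ.* p ≡ 2ℚ)
p²≢2 p@(mkℚ n d-1 n⊥d) p²≡2 with ℚᵘ.≃-trans (ℚᵘ.≃-sym (ℚ.toℚᵘ-homo-* p p)) (ℚ.toℚᵘ-cong p²≡2)
... | *≡* eq = m²≢2n² ℤ.∣ n ∣ (suc d-1) (recompute n⊥d) (begin
    ℤ.∣ n ∣ ℕ.* ℤ.∣ n ∣                      ≡⟨ ℤ.abs-* n n ⟨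
    ℤ.∣ n ℤ.* n ∣                            ≡⟨ cong ℤ.∣_∣ (ℤ.*-identityʳ (n ℤ.* n)) ⟨
    ℤ.∣ n ℤ.* n ℤ.* + 1 ∣                    ≡⟨ cong ℤ.∣_∣ eq ⟩
    2 ℕ.* (suc d-1 ℕ.* suc d-1)              ∎)
  where open ≡-Reasoning

module _ where
  open Data.Rational.Solver.+-*-Solver

  2-nonsquare : NonSquare ℚ-field 2ℚ
  2-nonsquare a b a²≡2b² with b ℚ.≟ 0ℚ
  ... | yes b≡0 = b≡0
  ... | no  b≢0 = contradiction (begin
      (a ℚ.* c) ℚ.* (a ℚ.* c)          ≡⟨ solve 2 (λ a c → a :* c :* (a :* c) := a :* a :* (c :* c)) refl a c ⟩
      (a ℚ.* a) ℚ.* (c ℚ.* c)          ≡⟨ cong (ℚ._* (c ℚ.* c)) a²≡2b² ⟩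
      2ℚ ℚ.* (b ℚ.* b) ℚ.* (c ℚ.* c)   ≡⟨ solve 2 (λ b c → con 2ℚ :* (b :* b) :* (c :* c) := con 2ℚ :* ((c :* b) :* (c :* b))) refl b c ⟩
      2ℚ ℚ.* ((c ℚ.* b) ℚ.* (c ℚ.* b)) ≡⟨ cong (λ x → 2ℚ ℚ.* (x ℚ.* x)) (ℚ.*-inverseˡ b) ⟩
      2ℚ                               ∎) (p²≢2 (a ℚ.* c))
    where
    open ≡-Reasoning
    instance _ = ≢-nonZero b≢0
    c = 1/ b

  0≤p² : ∀ p → 0ℚ ℚ.≤ p ℚ.* p
  0≤p² p with ℚ.≤-total 0ℚ p
  ... | inj₁ 0≤p = subst (ℚ._≤ p ℚ.* p) (ℚ.*-zeroˡ p) (ℚ.*-monoʳ-≤-nonNeg p {{nonNegative 0≤p}} 0≤p)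
  ... | inj₂ p≤0 = subst₂ ℚ._≤_ (ℚ.*-zeroˡ (ℚ.- p)) (solve 1 (λ p → :- p :* :- p := p :* p) refl p)
    (ℚ.*-monoʳ-≤-nonNeg (ℚ.- p) {{nonNegative 0≤-p}} 0≤-p)
    where
    0≤-p : 0ℚ ℚ.≤ ℚ.- p
    0≤-p = ℚ.neg-antimono-≤ p≤0

0≤p+q : ∀ {p q} → 0ℚ ℚ.≤ p → 0ℚ ℚ.≤ q → 0ℚ ℚ.≤ p ℚ.+ q
0≤p+q = ℚ.+-mono-≤

p+q≡0⇒p≡0 : ∀ {p q} → 0ℚ ℚ.≤ p → 0ℚ ℚ.≤ q → p ℚ.+ q ≡ 0ℚ → p ≡ 0ℚ
p+q≡0⇒p≡0 {p} 0≤p 0≤q p+q≡0 =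
  ℚ.≤-antisym (subst₂ ℚ._≤_ (ℚ.+-identityʳ p) p+q≡0 (ℚ.+-monoʳ-≤ p 0≤q)) 0≤p

p²≡0⇒p≡0 : ∀ p → p ℚ.* p ≡ 0ℚ → p ≡ 0ℚ
p²≡0⇒p≡0 p p²≡0 with p ℚ.≟ 0ℚ
... | yes p≡0 = p≡0
... | no  p≢0 = DiscreteField.x*y≈0⇒y≈0 ℚ-field p≢0 p²≡0

p²+q≡0 : ∀ p {q} → 0ℚ ℚ.≤ q → p ℚ.* p ℚ.+ q ≡ 0ℚ → p ≡ 0ℚ × q ≡ 0ℚ
p²+q≡0 p {q} 0≤q p²+q≡0 =
  p²≡0⇒p≡0 p (p+q≡0⇒p≡0 (0≤p² p) 0≤q p²+q≡0) ,
  p+q≡0⇒p≡0 0≤q (0≤p² p) (trans (ℚ.+-comm q (p ℚ.* p)) p²+q≡0)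

-- The tower ℚ ⊂ ℚ(√2) ⊂ K and positivity of the relative norm

module ℚ√2 = QuadraticField ℚ-field 2ℚ 2-nonsquare
L-field : DiscreteField
L-field = ℚ√2.field[√]

module L = DiscreteField L-field

-[2+√2] : L.Carrier
-[2+√2] = L.- (ℚ√2.ι 2ℚ L.+ ℚ√2.√d)

-- Only the ring structure is available here: the norm of this ring is used to prove the
-- nonsquareness that makes it a field.
private module L⁰ = QuadraticRing L.commutativeRing -[2+√2]

-- The rational part of a² + (2 + √2) b², half its trace to ℚ, is a₀² + 2 a₁² + 2 b₀² + 4 b₀ b₁ + 4
-- b₁². Completing the square gives a₀² plus twice this sum of three squares.
semitrace : L.Carrier → L.Carrier → ℚ
semitrace (a₀ , a₁) (b₀ , b₁) = (b₀ ℚ.+ b₁) ℚ.* (b₀ ℚ.+ b₁) ℚ.+ (b₁ ℚ.* b₁ ℚ.+ a₁ ℚ.* a₁)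

0≤semitrace : ∀ a b → 0ℚ ℚ.≤ semitrace a b
0≤semitrace (a₀ , a₁) (b₀ , b₁) = 0≤p+q (0≤p² (b₀ ℚ.+ b₁)) (0≤p+q (0≤p² b₁) (0≤p² a₁))

module _ where
  open Data.Rational.Solver.+-*-Solver

  rationalPart-norm : ∀ a b → proj₁ (L⁰.norm (a , b)) ≡
                      semitrace a b ℚ.+ (semitrace a b ℚ.+ proj₁ a ℚ.* proj₁ a)
  rationalPart-norm (a₀ , a₁) (b₀ , b₁) = solve 4 (λ a₀ a₁ b₀ b₁ →
    (a₀ :* a₀ :+ con 2ℚ :* (a₁ :* a₁)) :+
      -- The constants -2 and -1 are the coordinates of -(2 + √2); the factor 2 in front of the
      -- second product is the square of √2.
      (con (ℚ.- 2ℚ) :* (b₀ :* (:- b₀) :+ con 2ℚ :* (b₁ :* (:- b₁)))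
        :+ con 2ℚ :* (con (ℚ.- 1ℚ) :* (b₀ :* (:- b₁) :+ b₁ :* (:- b₀)))) :=
    ((b₀ :+ b₁) :* (b₀ :+ b₁) :+ (b₁ :* b₁ :+ a₁ :* a₁)) :+
      (((b₀ :+ b₁) :* (b₀ :+ b₁) :+ (b₁ :* b₁ :+ a₁ :* a₁)) :+ a₀ :* a₀))
    refl a₀ a₁ b₀ b₁

0≤rationalPart-norm : ∀ a b → 0ℚ ℚ.≤ proj₁ (L⁰.norm (a , b))
0≤rationalPart-norm a b = subst (0ℚ ℚ.≤_) (sym (rationalPart-norm a b))
  (0≤p+q (0≤semitrace a b) (0≤p+q (0≤semitrace a b) (0≤p² (proj₁ a))))

-- The hypothesis makes the norm of (a , b) vanish. Its rational part is a sum of squares, so each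
-- square vanishes, in particular those of b₀ + b₁ and b₁.
-[2+√2]-nonsquare : NonSquare L-field -[2+√2]
-[2+√2]-nonsquare a@(a₀ , a₁) b@(b₀ , b₁) a²≈db² = b₀≡0 , b₁≡0
  where
  semitrace≡0 : semitrace a b ≡ 0ℚ
  semitrace≡0 = p+q≡0⇒p≡0 (0≤semitrace a b) (0≤p+q (0≤semitrace a b) (0≤p² a₀))
    (trans (sym (rationalPart-norm a b)) (proj₁ (L⁰.a²≈db²⇒norm≈0 {a} {b} a²≈db²)))
  b₀+b₁≡0 : b₀ ℚ.+ b₁ ≡ 0ℚ
  b₀+b₁≡0 = proj₁ (p²+q≡0 (b₀ ℚ.+ b₁) (0≤p+q (0≤p² b₁) (0≤p² a₁)) semitrace≡0)
  b₁≡0 : b₁ ≡ 0ℚ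
  b₁≡0 = proj₁ (p²+q≡0 b₁ (0≤p² a₁) (proj₂ (p²+q≡0 (b₀ ℚ.+ b₁) (0≤p+q (0≤p² b₁) (0≤p² a₁)) semitrace≡0)))
  b₀≡0 : b₀ ≡ 0ℚ
  b₀≡0 = trans (sym (ℚ.+-identityʳ b₀)) (trans (cong (b₀ ℚ.+_) (sym b₁≡0)) b₀+b₁≡0)

module L√ = QuadraticField L-field -[2+√2] -[2+√2]-nonsquare
K-field : DiscreteField
K-field = L√.field[√]

module K = DiscreteField K-field

-- The rational coordinate of the product is that of the norm by computation, so equality would
-- yield 0 ≤ -1.
norm≉-1 : ∀ a b → ¬ ((a , b) K.* (a , L.- b) K.≈ K.- K.1#)
norm≉-1 a b eq = contradiction (subst (0ℚ ℚ.≤_) (proj₁ (proj₁ eq)) (0≤rationalPart-norm a b)) λ { (ℚ.*≤* ()) }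

ℚᶠ Lᶠ Kᶠ : Field
ℚᶠ = DiscreteField.field′ ℚ-field
Lᶠ = L.field′
Kᶠ = K.field′

L/ℚ : Extension ℚᶠ Lᶠ
L/ℚ = ℚ√2.extension

K/L : Extension Lᶠ Kᶠ
K/L = L√.extension

K/ℚ : Extension ℚᶠ Kᶠ
K/ℚ = K/L ∘ᴱ L/ℚ

-- The conjugate 2 - √2 equals (2 + √2)(1 - √2)², so ε β is a square root of the conjugate of β²,
-- and √2 ↦ -√2 extends to K.
ε : L.Carrier
ε = L.1# L.- ℚ√2.√d

module σ = L√.Twist ℚ√2.conj ℚ√2.conj-isRingHomomorphism ε (refl , refl)
open σ using () renaming (twist to σ; twist-isRingHomomorphism to σ-isRingHomomorphism) public

σ-cong : ∀ {x y} → x K.≈ y → σ x K.≈ σ y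
σ-cong = Hom.IsRingHomomorphism.⟦⟧-cong K.ring K.ring σ-isRingHomomorphism

-- The unit ε has norm (1 + √2)(1 - √2) = -1 over ℚ, so σ² sends β to -β. This sign is why σ has
-- order 4 and K is cyclic rather than biquadratic.
σ²≈conj : ∀ x → σ (σ x) K.≈ L√.conj x
σ²≈conj (a , b) = ℚ√2.conj-involutive a , (begin
  θ (θ b L.* ε) L.* ε        ≈⟨ L.*-congʳ {ε} {θ (θ b L.* ε)} {θ (θ b) L.* θ ε} (θ.*-homo (θ b) ε) ⟩
  θ (θ b) L.* θ ε L.* ε      ≈⟨ L.*-assoc (θ (θ b)) (θ ε) ε ⟩
  θ (θ b) L.* (θ ε L.* ε)    ≈⟨ L.*-cong {θ (θ b)} {b} {θ ε L.* ε} {L.- L.1#} (ℚ√2.conj-involutive b) (refl , refl) ⟩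
  b L.* L.- L.1#             ∎)
  where
  open Relation.Binary.Reasoning.Setoid L.setoid
  θ = ℚ√2.conj
  module θ = Hom.IsRingHomomorphism L.ring L.ring ℚ√2.conj-isRingHomomorphism

σ⁴≈id : ∀ x → σ (σ (σ (σ x))) K.≈ x
σ⁴≈id x = K.trans (σ²≈conj (σ (σ x))) (K.trans (conj-cong (σ²≈conj x)) (L√.conj-involutive x))
  where
  conj-cong : ∀ {x y} → x K.≈ y → L√.conj x K.≈ L√.conj y
  conj-cong = Hom.IsRingHomomorphism.⟦⟧-cong K.ring K.ring L√.conj-isRingHomomorphism

-- The Galois groups of K over ℚ and over L

σᴳ : Gal K/ℚ
σᴳ = record
  { apply = σ
  ; isRingIsomorphism = Hom.mkIso K.ring K.ring σ-isRingHomomorphism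
      (λ p → σ-cong (σ-cong (σ-cong p))) σ⁴≈id σ⁴≈id
  ; fixesBase = λ c → (refl , refl) , (refl , refl)
  }

√2ᴷ : K.Carrier
√2ᴷ = L√.ι ℚ√2.√d

K/ℚ-hasDegree-4 : HasDegree K/ℚ 4
K/ℚ-hasDegree-4 = IsCoordinateSystem.hasDimension {A = extensionAlgebra K/ℚ} {n = 4} {e = e} {coord = coord} record
  { coord-cong      = λ { p 0F → proj₁ (proj₁ p) ; p 1F → proj₂ (proj₁ p) ; p 2F → proj₁ (proj₂ p) ; p 3F → proj₂ (proj₂ p) }
  ; coord-injective = λ p → (p 0F , p 1F) , (p 2F , p 3F)
  ; coord-+         = λ { x y 0F → refl ; x y 1F → refl ; x y 2F → refl ; x y 3F → refl }
  ; coord-*         = λ { c x 0F → proj₁ (proj₁ (scale c x)) ; c x 1F → proj₂ (proj₁ (scale c x))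
                        ; c x 2F → proj₁ (proj₂ (scale c x)) ; c x 3F → proj₂ (proj₂ (scale c x)) }
  ; coord-basis     = from-yes (Fin.all? λ j → Fin.all? λ i → coord (e j) i ℚ.≟ kronecker ℚᶠ i j)
  }
  where
  e : Vector K.Carrier 4
  e 0F = K.1#
  e 1F = √2ᴷ
  e 2F = L√.√d
  e 3F = L.0# , ℚ√2.√d
  coord : K.Carrier → Vector ℚ 4
  coord ((x₀ , x₁) , (x₂ , x₃)) 0F = x₀
  coord ((x₀ , x₁) , (x₂ , x₃)) 1F = x₁
  coord ((x₀ , x₁) , (x₂ , x₃)) 2F = x₂
  coord ((x₀ , x₁) , (x₂ , x₃)) 3F = x₃
  _•_ : ℚ → L.Carrier → L.Carrier
  c • (a , b) = c ℚ.* a , c ℚ.* b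
  scale : ∀ c x → L√.ι (ℚ√2.ι c) K.* x K.≈ (c • proj₁ x , c • proj₂ x)
  scale c (a , b) = K.trans (L√.ι-* (ℚ√2.ι c) (a , b)) (ℚ√2.ι-* c a , ℚ√2.ι-* c b)

σι≈ιconj : ∀ a → σ (L√.ι a) K.≈ L√.ι (ℚ√2.conj a)
σι≈ιconj a = L.refl , L.zeroˡ ε

-- The dichotomy is used twice. The restriction of τ to L is the inclusion or its conjugate; these
-- extend to K by the identity and by σ, and any other extension differs from them by σ². The four
-- outcomes are the powers of σ.
K/ℚ-galois-group : ∀ (τ : Gal K/ℚ) → Σ[ i ∈ Fin 4 ] _≈ᴳ_ K/ℚ (powerᴳ K/ℚ σᴳ (toℕ i)) τ
K/ℚ-galois-group τ = [ case-fixes-L , case-moves-L ]′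
  (ℚ√2.hom-dichotomy K-field τι-hom L√.ι-isRingHomomorphism (Gal.fixesBase τ))
  where
  τ-hom : Hom.IsRingHomomorphism K.ring K.ring (apply τ)
  τ-hom = homomorphism K/ℚ τ
  τι-hom : Hom.IsRingHomomorphism L.ring K.ring (apply τ ∘ L√.ι)
  τι-hom = Composition.isRingHomomorphism K.trans L√.ι-isRingHomomorphism τ-hom
  case-fixes-L : (∀ a → apply τ (L√.ι a) K.≈ L√.ι a) → Σ[ i ∈ Fin 4 ] _≈ᴳ_ K/ℚ (powerᴳ K/ℚ σᴳ (toℕ i)) τ
  case-fixes-L τ≈id-L =
    [ (λ τ≈id   → 0F , λ x → K.sym (τ≈id x))
    , (λ τ≈conj → 2F , λ x → K.trans (σ²≈conj x) (K.sym (τ≈conj x)))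
    ]′ (L√.hom-dichotomy K-field τ-hom (homomorphism K/ℚ (idᴳ K/ℚ)) τ≈id-L)
  case-moves-L : (∀ a → apply τ (L√.ι a) K.≈ L√.ι (ℚ√2.conj a)) → Σ[ i ∈ Fin 4 ] _≈ᴳ_ K/ℚ (powerᴳ K/ℚ σᴳ (toℕ i)) τ
  case-moves-L τ≈conj-L =
    [ (λ τ≈σ     → 1F , λ x → K.sym (τ≈σ x))
    , (λ τ≈σconj → 3F , λ x → K.trans (σ-cong (σ²≈conj x)) (K.sym (τ≈σconj x)))
    ]′ (L√.hom-dichotomy K-field τ-hom σ-isRingHomomorphism (λ a → K.trans (τ≈conj-L a) (K.sym (σι≈ιconj a))))

K/ℚ-isGenerator : IsGenerator K/ℚ σᴳ
K/ℚ-isGenerator τ = let i , σⁱ≈τ = K/ℚ-galois-group τ in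
  toℕ i , λ x → K.trans (K.sym (σⁱ≈τ x)) (K.reflexive (apply-powerᴳ K/ℚ σᴳ (toℕ i) x))

K/ℚ-enumeration : Bijective _≡_ (_≈ᴳ_ K/ℚ) (powerᴳ K/ℚ σᴳ ∘ toℕ {4})
K/ℚ-enumeration = (λ {i} {j} σⁱ≈σʲ → distinct i j (σⁱ≈σʲ L√.√d)) ,
  λ τ → let i , σⁱ≈τ = K/ℚ-galois-group τ in i , λ { refl → σⁱ≈τ }
  where
  -- The four powers are told apart by their values β, εβ, -β, -εβ at β, which are compared by
  -- computation.
  distinct : ∀ i j → apply (powerᴳ K/ℚ σᴳ (toℕ i)) L√.√d K.≈ apply (powerᴳ K/ℚ σᴳ (toℕ j)) L√.√d → i ≡ j
  distinct = from-yes (Fin.all? {4} λ i → Fin.all? λ j →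
    (apply (powerᴳ K/ℚ σᴳ (toℕ i)) L√.√d K.≟ apply (powerᴳ K/ℚ σᴳ (toℕ j)) L√.√d) →-dec (i Fin.≟ j))

conjᴳ : Gal K/L
conjᴳ = record
  { apply = L√.conj
  ; isRingIsomorphism = Hom.mkIso K.ring K.ring L√.conj-isRingHomomorphism conj-cong
      L√.conj-involutive L√.conj-involutive
  ; fixesBase = λ a → L.refl , L.zeroˡ (L.- L.1#)
  }
  where
  conj-cong : ∀ {x y} → x K.≈ y → L√.conj x K.≈ L√.conj y
  conj-cong = Hom.IsRingHomomorphism.⟦⟧-cong K.ring K.ring L√.conj-isRingHomomorphism

K/L-enumeration : Bijective _≡_ (_≈ᴳ_ K/L) (powerᴳ K/L conjᴳ ∘ toℕ {2})
K/L-enumeration = (λ {i} {j} → distinct i j) , surjective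
  where
  distinct : ∀ i j → (∀ x → apply (powerᴳ K/L conjᴳ (toℕ i)) x K.≈ apply (powerᴳ K/L conjᴳ (toℕ j)) x) → i ≡ j
  distinct i j eq = from-yes (Fin.all? {2} λ i → Fin.all? λ j →
    (apply (powerᴳ K/L conjᴳ (toℕ i)) L√.√d K.≟ apply (powerᴳ K/L conjᴳ (toℕ j)) L√.√d) →-dec (i Fin.≟ j)) i j (eq L√.√d)
  surjective : ∀ τ → ∃[ i ] (∀ {z} → z ≡ i → _≈ᴳ_ K/L (powerᴳ K/L conjᴳ (toℕ z)) τ)
  surjective τ =
    [ (λ τ≈id   → 0F , λ { refl x → K.sym (τ≈id x) })
    , (λ τ≈conj → 1F , λ { refl x → K.sym (τ≈conj x) })
    ]′ (L√.hom-dichotomy K-field (homomorphism K/L τ) (homomorphism K/L (idᴳ K/L)) (Gal.fixesBase τ))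

-- Two automorphisms suffice: invariance under σ² kills the coefficient of β, and invariance under σ
-- kills that of √2.
K/ℚ-isGalois : IsGalois K/ℚ
K/ℚ-isGalois x@((a₀ , a₁) , b@(b₀ , b₁)) fixed =
  a₀ , ((refl , sym (q≡-q⇒q≡0 a₁ (proj₂ (proj₁ (K.trans (K.sym (fixed σᴳ)) (conj-part)))))) ,
        (sym (q≡-q⇒q≡0 b₀ (proj₁ b≈-b)) , sym (q≡-q⇒q≡0 b₁ (proj₂ b≈-b))))
  where
  q≡-q⇒q≡0 : ∀ q → q ≡ ℚ.- q → q ≡ 0ℚ
  q≡-q⇒q≡0 q q≡-q = DiscreteField.x*y≈0⇒y≈0 ℚ-field {2ℚ} {q} (λ ()) (trans (solve 1 (λ q → con 2ℚ :* q := q :+ q) refl q)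
    (trans (cong (q ℚ.+_) q≡-q) (ℚ.+-inverseʳ q)))
    where open Data.Rational.Solver.+-*-Solver
  conj-part : σ x K.≈ ((a₀ , ℚ.- a₁) , ℚ√2.conj b L.* ε)
  conj-part = ℚ√2.conj≈[a,-b] (a₀ , a₁) , L.refl
  b≈-b : b L.≈ L.- b
  b≈-b = proj₂ (K.trans (K.sym (fixed (powerᴳ K/ℚ σᴳ 2))) (K.trans (σ²≈conj x) (L√.conj≈[a,-b] x)))

-- Norms from K and the value of m

y*conj-y≉-1 : ∀ y → ¬ (K.- K.1# K.≈ y K.* L√.conj y)
y*conj-y≉-1 y@(a , b) -1≈yȳ = norm≉-1 a b (K.trans (K.*-congˡ {y} (K.sym (L√.conj≈[a,-b] y))) (K.sym -1≈yȳ))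

-1-notNorm-K/L : ¬ InNormGroup K/L (L.- L.1#)
-1-notNorm-K/L (x , _ , isNorm) = y*conj-y≉-1 x
  (K.trans (norm-as-product K/L (powerᴳ K/L conjᴳ ∘ toℕ) K/L-enumeration isNorm) (K.*-congˡ {x} (K.*-identityʳ (L√.conj x))))

-- N_{K/ℚ}(x) = y ȳ for y = x σ(x).
-1-notNorm-K/ℚ : ¬ InNormGroup K/ℚ (ℚ.- 1ℚ)
-1-notNorm-K/ℚ (x , _ , isNorm) = y*conj-y≉-1 (x K.* σ x) (begin
  K.- K.1#                                                    ≈⟨ norm-as-product K/ℚ (powerᴳ K/ℚ σᴳ ∘ toℕ) K/ℚ-enumeration isNorm ⟩
  x K.* (σ x K.* (σ (σ x) K.* (σ (σ (σ x)) K.* K.1#)))         ≈⟨ K.*-assoc x (σ x) _ ⟨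
  x K.* σ x K.* (σ (σ x) K.* (σ (σ (σ x)) K.* K.1#))           ≈⟨ K.*-congˡ {x K.* σ x} (K.*-cong (σ²≈conj x) (K.trans (K.*-identityʳ (σ (σ (σ x)))) (σ²≈conj (σ x)))) ⟩
  x K.* σ x K.* (L√.conj x K.* L√.conj (σ x))                  ≈⟨ K.*-congˡ {x K.* σ x} (conj.*-homo x (σ x)) ⟨
  x K.* σ x K.* L√.conj (x K.* σ x)                            ∎)
  where
  open Relation.Binary.Reasoning.Setoid K.setoid
  module conj = Hom.IsRingHomomorphism K.ring K.ring L√.conj-isRingHomomorphism

ℚ⊂L⊂K : Tower K/ℚ 2 2
ℚ⊂L⊂K = record
  { level = λ
    { 0F → record { E = ℚᶠ ; E/F = identityExtension ℚᶠ ; K/E = K/ℚ ; compatible = λ _ → K.refl }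
    ; 1F → record { E = Lᶠ ; E/F = L/ℚ ; K/E = K/L ; compatible = λ _ → K.refl }
    ; 2F → record { E = Kᶠ ; E/F = K/ℚ ; K/E = identityExtension Kᶠ ; compatible = λ _ → K.refl }
    }
  ; degree = λ { 0F → hasDegree-1 ℚᶠ ; 1F → ℚ√2.hasDegree-2 ; 2F → K/ℚ-hasDegree-4 }
  }

m[K/ℚ]≡1 : IsM ℚ⊂L⊂K (ℚ.- 1ℚ) [ 1 ]
m[K/ℚ]≡1 = -1-notNorm-K/ℚ , 2F , norm-from-K , minimal , refl
  where
  norm-from-K : InNormGroup (identityExtension Kᶠ) (K.- K.1#)
  -- Over K itself the Galois group is trivial, so -1 is its own norm. The minimum is thus s = 2,
  -- and m is one less.
  norm-from-K = K.- K.1# , (λ ()) ∘ proj₁ ∘ proj₁ , 1 , (λ _ → idᴳ (identityExtension Kᶠ)) ,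
    ((λ { {0F} {0F} _ → refl }) , (λ τ → 0F , λ _ x → K.sym (Gal.fixesBase τ x))) ,
    K.sym (K.*-identityʳ (K.- K.1#))
  minimal : ∀ t → IsNormFromTopTo ℚ⊂L⊂K (ℚ.- 1ℚ) t → 2 ℕ.≤ toℕ t
  minimal 0F isNorm = contradiction isNorm -1-notNorm-K/ℚ
  minimal 1F isNorm = contradiction isNorm -1-notNorm-K/L
  minimal 2F _      = ℕ.s≤s (ℕ.s≤s ℕ.z≤n)

-- Hamilton quaternions over ℚ

module Hamilton (R : RawRing 0ℓ 0ℓ) where
  open RawRing R

  ℍ : Set
  ℍ = Carrier × Carrier × Carrier × Carrier

  infixl 7 _⊗_
  _⊗_ : ℍ → ℍ → ℍ
  (a₀ , a₁ , a₂ , a₃) ⊗ (b₀ , b₁ , b₂ , b₃) =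
    a₀ * b₀ + - (a₁ * b₁) + - (a₂ * b₂) + - (a₃ * b₃) ,
    a₀ * b₁ + a₁ * b₀ + a₂ * b₃ + - (a₃ * b₂) ,
    a₀ * b₂ + - (a₁ * b₃) + a₂ * b₀ + a₃ * b₁ ,
    a₀ * b₃ + a₁ * b₂ + - (a₂ * b₁) + a₃ * b₀

  infixl 6 _⊕_
  _⊕_ : ℍ → ℍ → ℍ
  (a₀ , a₁ , a₂ , a₃) ⊕ (b₀ , b₁ , b₂ , b₃) = a₀ + b₀ , a₁ + b₁ , a₂ + b₂ , a₃ + b₃

  𝟙 : ℍ
  𝟙 = 1# , 0# , 0# , 0#

open Hamilton (DiscreteField.rawRing ℚ-field) using (ℍ; _⊗_; 𝟙)

private
  +ᴴ : AbelianGroup 0ℓ 0ℓ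
  +ᴴ = DirectProduct.abelianGroup ℚ⁺ (DirectProduct.abelianGroup ℚ⁺ (DirectProduct.abelianGroup ℚ⁺ ℚ⁺))
    where
    ℚ⁺ : AbelianGroup 0ℓ 0ℓ
    ℚ⁺ = DiscreteField.+-abelianGroup ℚ-field

  module + = AbelianGroup +ᴴ

pattern rfl = refl , refl , refl , refl

-- An identity of quaternions is four polynomial identities in their coordinates;
-- its two sides are written with the operations of Hamilton over polynomials.
module QuaternionSolver where
  open Data.Rational.Solver.+-*-Solver public using (Polynomial; con; var; :-_; _:+_; _:*_)
  open Data.Rational.Solver.+-*-Solver using (⟦_⟧; ⟦_⟧↓; prove)

  polynomials : ℕ → RawRing 0ℓ 0ℓ
  polynomials n = record
    { Carrier = Polynomial n
    ; _≈_ = _≡_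
    ; _+_ = _:+_
    ; _*_ = _:*_
    ; -_ = :-_
    ; 0# = con 0ℚ
    ; 1# = con 1ℚ
    }

  module _ {n : ℕ} where
    open Hamilton (polynomials n) public using () renaming (ℍ to ℍₚ; _⊗_ to _:⊗_; _⊕_ to _:⊕_; 𝟙 to :𝟙)

    coordinatewise : (Polynomial n → Vec ℚ n → ℚ) → ℍₚ → Vec ℚ n → ℍ
    coordinatewise eval (x₀ , x₁ , x₂ , x₃) ρ = eval x₀ ρ , eval x₁ ρ , eval x₂ ρ , eval x₃ ρ

    proveᴴ : ∀ (x y : ℍₚ) ρ → coordinatewise ⟦_⟧↓ x ρ +.≈ coordinatewise ⟦_⟧↓ y ρ →
             coordinatewise ⟦_⟧ x ρ +.≈ coordinatewise ⟦_⟧ y ρ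
    proveᴴ (x₀ , x₁ , x₂ , x₃) (y₀ , y₁ , y₂ , y₃) ρ (p₀ , p₁ , p₂ , p₃) =
      prove ρ x₀ y₀ p₀ , prove ρ x₁ y₁ p₁ , prove ρ x₂ y₂ p₂ , prove ρ x₃ y₃ p₃

private module Ring-laws where
  open QuaternionSolver

  -- Variable 4 doubles as a scalar n. Here `x̄` is n times the quaternion conjugate of x and `∣x∣²`
  -- is n times its norm, so taking n to be the inverse of the norm yields the inverse of x.
  x y z x̄ ∣x∣² : ℍₚ {12}
  x = var 0F , var 1F , var 2F , var 3F
  y = var 4F , var 5F , var 6F , var 7F
  z = var 8F , var 9F , var (# 10) , var (# 11)
  x̄ = var 4F :* var 0F , var 4F :* :- var 1F , var 4F :* :- var 2F , var 4F :* :- var 3F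
  ∣x∣² = var 4F :* (var 0F :* var 0F :+ (var 1F :* var 1F :+ (var 2F :* var 2F :+ var 3F :* var 3F))) ,
         con 0ℚ , con 0ℚ , con 0ℚ

  ρ : ℍ → ℍ → ℍ → Vec ℚ 12
  ρ (a₀ , a₁ , a₂ , a₃) (b₀ , b₁ , b₂ , b₃) (c₀ , c₁ , c₂ , c₃) =
    a₀ ∷ a₁ ∷ a₂ ∷ a₃ ∷ b₀ ∷ b₁ ∷ b₂ ∷ b₃ ∷ c₀ ∷ c₁ ∷ c₂ ∷ c₃ ∷ []

  abstract
    isRing : IsRing +._≈_ +._∙_ _⊗_ +._⁻¹ +.ε 𝟙
    isRing = record
      { +-isAbelianGroup = +.isAbelianGroup
      ; *-cong = λ { rfl rfl → +.refl }
      ; *-assoc = λ a b c → proveᴴ (x :⊗ y :⊗ z) (x :⊗ (y :⊗ z)) (ρ a b c) rfl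
      ; *-identity =
          (λ a → proveᴴ (:𝟙 :⊗ x) x (ρ a a a) rfl) ,
          (λ a → proveᴴ (x :⊗ :𝟙) x (ρ a a a) rfl)
      ; distrib =
          (λ a b c → proveᴴ (x :⊗ (y :⊕ z)) (x :⊗ y :⊕ x :⊗ z) (ρ a b c) rfl) ,
          (λ a b c → proveᴴ ((y :⊕ z) :⊗ x) (y :⊗ x :⊕ z :⊗ x) (ρ a b c) rfl)
      }

    scalar-* : ∀ c a → (c , 0ℚ , 0ℚ , 0ℚ) ⊗ a +.≈ (c ℚ.* proj₁ a , c ℚ.* proj₁ (proj₂ a) , c ℚ.* proj₁ (proj₂ (proj₂ a)) , c ℚ.* proj₂ (proj₂ (proj₂ a)))
    scalar-* c a = proveᴴ ((var 4F , con 0ℚ , con 0ℚ , con 0ℚ) :⊗ x)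
      (var 4F :* var 0F , var 4F :* var 1F , var 4F :* var 2F , var 4F :* var 3F)
      (ρ a (c , c , c , c) a) rfl

    scalar-central : ∀ c a → (c , 0ℚ , 0ℚ , 0ℚ) ⊗ a +.≈ a ⊗ (c , 0ℚ , 0ℚ , 0ℚ)
    scalar-central c a = proveᴴ ((var 4F , con 0ℚ , con 0ℚ , con 0ℚ) :⊗ x) (x :⊗ (var 4F , con 0ℚ , con 0ℚ , con 0ℚ))
      (ρ a (c , c , c , c) a) rfl

    -- A sum of four rational squares vanishes only if all four terms do, so a nonzero quaternion
    -- has nonzero norm, and its conjugate divided by that norm is a two-sided inverse.
    inverseᴴ : ∀ a → ¬ (a +.≈ +.ε) → ∃[ b ] (b ⊗ a +.≈ 𝟙) × (a ⊗ b +.≈ 𝟙)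
    inverseᴴ a@(a₀ , a₁ , a₂ , a₃) a≉0 =
      let n , nN≡1 = DiscreteField.inverse ℚ-field N N≢0
          nN≈1 = nN≡1 , refl , refl , refl
      in (n ℚ.* a₀ , n ℚ.* ℚ.- a₁ , n ℚ.* ℚ.- a₂ , n ℚ.* ℚ.- a₃) ,
         +.trans (proveᴴ (x̄ :⊗ x) ∣x∣² (ρ a (n , n , n , n) a) rfl) nN≈1 ,
         +.trans (proveᴴ (x :⊗ x̄) ∣x∣² (ρ a (n , n , n , n) a) rfl) nN≈1
      where
      N₁ N₂ N : ℚ
      N₂ = a₂ ℚ.* a₂ ℚ.+ a₃ ℚ.* a₃
      N₁ = a₁ ℚ.* a₁ ℚ.+ N₂
      N = a₀ ℚ.* a₀ ℚ.+ N₁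
      0≤N₂ : 0ℚ ℚ.≤ N₂
      0≤N₂ = 0≤p+q (0≤p² a₂) (0≤p² a₃)
      0≤N₁ : 0ℚ ℚ.≤ N₁
      0≤N₁ = 0≤p+q (0≤p² a₁) 0≤N₂
      N≢0 : ¬ (N ≡ 0ℚ)
      N≢0 N≡0 =
        let a₀≡0 , N₁≡0 = p²+q≡0 a₀ 0≤N₁ N≡0
            a₁≡0 , N₂≡0 = p²+q≡0 a₁ 0≤N₂ N₁≡0
            a₂≡0 , a₃²≡0 = p²+q≡0 a₂ (0≤p² a₃) N₂≡0
        in a≉0 (a₀≡0 , a₁≡0 , a₂≡0 , p²≡0⇒p≡0 a₃ a₃²≡0)

quaternions : Algebra ℚᶠ
quaternions = record
  { ring = record { isRing = Ring-laws.isRing }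
  ; algebraMap = λ c → c , 0ℚ , 0ℚ , 0ℚ
  ; isRingHomomorphism = Hom.mkHom (DiscreteField.ring ℚ-field) (record { isRing = Ring-laws.isRing })
      (λ { refl → +.refl })
      (λ c c′ → +.refl)
      (λ c c′ → +.sym (+.trans (Ring-laws.scalar-* c _) (refl , ℚ.*-zeroʳ c , ℚ.*-zeroʳ c , ℚ.*-zeroʳ c)))
      +.refl
  ; central = Ring-laws.scalar-central
  }

quaternions-isDivisionAlgebra : IsDivisionAlgebra quaternions
quaternions-isDivisionAlgebra = (λ ()) ∘ proj₁ , Ring-laws.inverseᴴ

quaternions-hasDimension-4 : HasDimension quaternions 4
quaternions-hasDimension-4 = IsCoordinateSystem.hasDimension {A = quaternions} {n = 4} {e = e} {coord = coord} record
  { coord-cong      = λ { p 0F → proj₁ p ; p 1F → proj₁ (proj₂ p) ; p 2F → proj₁ (proj₂ (proj₂ p)) ; p 3F → proj₂ (proj₂ (proj₂ p)) }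
  ; coord-injective = λ p → p 0F , p 1F , p 2F , p 3F
  ; coord-+         = λ { a b 0F → refl ; a b 1F → refl ; a b 2F → refl ; a b 3F → refl }
  ; coord-*         = λ { c a 0F → proj₁ (Ring-laws.scalar-* c a) ; c a 1F → proj₁ (proj₂ (Ring-laws.scalar-* c a))
                        ; c a 2F → proj₁ (proj₂ (proj₂ (Ring-laws.scalar-* c a))) ; c a 3F → proj₂ (proj₂ (proj₂ (Ring-laws.scalar-* c a))) }
  ; coord-basis     = from-yes (Fin.all? λ j → Fin.all? λ i → coord (e j) i ℚ.≟ kronecker ℚᶠ i j)
  }
  where
  e : Vector ℍ 4
  e 0F = 1ℚ , 0ℚ , 0ℚ , 0ℚ
  e 1F = 0ℚ , 1ℚ , 0ℚ , 0ℚ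
  e 2F = 0ℚ , 0ℚ , 1ℚ , 0ℚ
  e 3F = 0ℚ , 0ℚ , 0ℚ , 1ℚ
  coord : ℍ → Vector ℚ 4
  coord (a₀ , a₁ , a₂ , a₃) 0F = a₀
  coord (a₀ , a₁ , a₂ , a₃) 1F = a₁
  coord (a₀ , a₁ , a₂ , a₃) 2F = a₂
  coord (a₀ , a₁ , a₂ , a₃) 3F = a₃

-- M₂(ℍ) as a cyclic algebra

open MatrixAlgebra quaternions 2 using (matrixAlgebra; isMatrixAlgebra)

M₂ℍ : Algebra ℚᶠ
M₂ℍ = matrixAlgebra
module A = Algebra M₂ℍ
module ℍ = Algebra quaternions

matrix : ℍ.Carrier → ℍ.Carrier → ℍ.Carrier → ℍ.Carrier → A.Carrier
matrix a b c d 0F 0F = a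
matrix a b c d 0F 1F = b
matrix a b c d 1F 0F = c
matrix a b c d 1F 1F = d

𝟎 𝐢 𝐣 𝐤 : ℍ.Carrier
𝟎 = ℍ.0#
𝐢 = 0ℚ , 1ℚ , 0ℚ , 0ℚ
𝐣 = 0ℚ , 0ℚ , 1ℚ , 0ℚ
𝐤 = 0ℚ , 0ℚ , 0ℚ , 1ℚ

-- The square of u is the diagonal matrix with entries i, so conjugation by that matrix has to
-- realise σ². As σ² fixes √2, the entries of α lie in ℚ(i), and α² = 2 because 2 = (1 + i)(1 - i).
-- As σ² negates β, the entries of β lie in ℚj + ℚk, which anticommutes with i. Finally u⁻¹ = -u³.
α β u u⁻¹ : A.Carrier
α = matrix 𝟎 (ℍ.1# ℍ.+ 𝐢) (ℍ.1# ℍ.- 𝐢) 𝟎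
β = matrix (ℍ.- 𝐤) (ℍ.- 𝐣) (ℍ.- 𝐣) (ℍ.- 𝐣)
u = matrix 𝟎 (ℍ.- ℍ.1#) (ℍ.- 𝐢) 𝟎
u⁻¹ = matrix 𝟎 𝐢 (ℍ.- ℍ.1#) 𝟎

entrywise : ∀ {x y : A.Carrier} → x 0F 0F ℍ.≈ y 0F 0F → x 0F 1F ℍ.≈ y 0F 1F →
            x 1F 0F ℍ.≈ y 1F 0F → x 1F 1F ℍ.≈ y 1F 1F → x A.≈ y
entrywise p q r s 0F 0F = p
entrywise p q r s 0F 1F = q
entrywise p q r s 1F 0F = r
entrywise p q r s 1F 1F = s

abstract
  α² : α A.* α A.≈ A.algebraMap 2ℚ
  α² = entrywise rfl rfl rfl rfl

  uu⁻¹≈1 : u A.* u⁻¹ A.≈ A.1#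
  uu⁻¹≈1 = entrywise rfl rfl rfl rfl

  u⁻¹u≈1 : u⁻¹ A.* u A.≈ A.1#
  u⁻¹u≈1 = entrywise rfl rfl rfl rfl

  u⁴≈-1 : u A.^ 4 A.≈ A.algebraMap (ℚ.- 1ℚ)
  u⁴≈-1 = entrywise rfl rfl rfl rfl

  βα≈αβ : β A.* α A.≈ α A.* β
  βα≈αβ = entrywise rfl rfl rfl rfl

-- The embedding of K into M₂(ℍ) and conjugation by u

module embedL₁ = ℚ√2.Lift A.ring A.isRingHomomorphism α α² (λ c → A.sym (A.central c α))
open embedL₁ using () renaming (lift to L→A) public

abstract
  β²≈-[2+√2] : β A.* β A.≈ L→A -[2+√2]
  β²≈-[2+√2] = entrywise rfl rfl rfl rfl

  β-commutes : ∀ a → β A.* L→A a A.≈ L→A a A.* β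
  β-commutes = embedL₁.lift-commutes β (λ c → A.sym (A.central c β)) βα≈αβ

module embedL₂ = L√.Lift A.ring embedL₁.lift-isRingHomomorphism β β²≈-[2+√2] β-commutes
open embedL₂ using () renaming (lift to K→A; lift-isRingHomomorphism to K→A-isRingHomomorphism) public

open InnerAutomorphism A.ring u u⁻¹ uu⁻¹≈1 u⁻¹u≈1

private
  module inner = Hom.IsRingHomomorphism A.ring A.ring inner-isRingHomomorphism
  module K→A = Hom.IsRingHomomorphism K.ring A.ring K→A-isRingHomomorphism

K→A-ι : ∀ a → K→A (L√.ι a) A.≈ L→A a
K→A-ι = embedL₂.lift-ι

K→A-algebraMap : ∀ c → K→A (L√.ι (ℚ√2.ι c)) A.≈ A.algebraMap c
K→A-algebraMap c = A.trans (K→A-ι (ℚ√2.ι c)) (embedL₁.lift-ι c)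

abstract
  inner-α : inner α A.≈ K→A (σ (L√.ι ℚ√2.√d))
  inner-α = entrywise rfl rfl rfl rfl

  inner-β : inner β A.≈ K→A (σ L√.√d)
  inner-β = entrywise rfl rfl rfl rfl

K→Aσ-isRingHomomorphism : Hom.IsRingHomomorphism K.ring A.ring (K→A ∘ σ)
K→Aσ-isRingHomomorphism = Composition.isRingHomomorphism A.trans σ-isRingHomomorphism K→A-isRingHomomorphism

innerK→A-isRingHomomorphism : Hom.IsRingHomomorphism K.ring A.ring (inner ∘ K→A)
innerK→A-isRingHomomorphism = Composition.isRingHomomorphism A.trans K→A-isRingHomomorphism inner-isRingHomomorphism

-- Both sides are ring homomorphisms in x, so uniqueness over L and then over ℚ reduces the claim to
-- rational scalars, √2 and β. Scalars are central and fixed by σ; the other two are explicit matrix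
-- computations.
conjugation : ∀ x → inner (K→A x) A.≈ K→A (σ x)
conjugation = L√.hom-unique A.ring innerK→A-isRingHomomorphism K→Aσ-isRingHomomorphism on-L
  (A.trans {inner (K→A L√.√d)} {inner β} {K→A (σ L√.√d)} (inner.⟦⟧-cong {K→A L√.√d} {β} embedL₂.lift-√d) inner-β)
  where
  on-ℚ : ∀ c → inner (K→A (L√.ι (ℚ√2.ι c))) A.≈ K→A (σ (L√.ι (ℚ√2.ι c)))
  on-ℚ c = A.trans {inner (K→A ι²c)} {A.algebraMap c} {K→A (σ ι²c)}
    (A.trans {inner (K→A ι²c)} {inner (A.algebraMap c)} {A.algebraMap c}
      (inner.⟦⟧-cong {K→A ι²c} {A.algebraMap c} (K→A-algebraMap c))
      (inner-commuting {A.algebraMap c} (A.central c u)))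
    (A.sym {K→A (σ ι²c)} {A.algebraMap c} (A.trans {K→A (σ ι²c)} {K→A ι²c} {A.algebraMap c}
      (K→A.⟦⟧-cong {σ ι²c} {ι²c} (Gal.fixesBase σᴳ c)) (K→A-algebraMap c)))
    where ι²c = L√.ι (ℚ√2.ι c)
  on-L : ∀ a → inner (K→A (L√.ι a)) A.≈ K→A (σ (L√.ι a))
  on-L = ℚ√2.hom-unique A.ring
    (Composition.isRingHomomorphism A.trans L√.ι-isRingHomomorphism innerK→A-isRingHomomorphism)
    (Composition.isRingHomomorphism A.trans L√.ι-isRingHomomorphism K→Aσ-isRingHomomorphism)
    on-ℚ
    (A.trans {inner (K→A √2ᴷ)} {inner α} {K→A (σ √2ᴷ)} (inner.⟦⟧-cong {K→A √2ᴷ} {α}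
      (A.trans {K→A √2ᴷ} {L→A ℚ√2.√d} {α} (K→A-ι ℚ√2.√d) embedL₁.lift-√d)) inner-α)

-- Over any ring containing ½, since that combine and decompose are mutually inverse
-- is checked over polynomials.
module Coordinates (R : RawRing 0ℓ 0ℓ) (½ : RawRing.Carrier R) where
  open RawRing R
  open Hamilton R using (_⊕_) renaming (ℍ to H)

  Kᴿ Aᴿ : Set
  Kᴿ = (Carrier × Carrier) × (Carrier × Carrier)
  Aᴿ = Fin 2 → Fin 2 → H

  infix 8 ⊖_
  ⊖_ -𝐢·_ : H → H
  ⊖ (a , b , c , d) = - a , - b , - c , - d
  -𝐢· (a , b , c , d) = b , - a , d , - c

  -- The entries of (x₀ + x₁α) + (x₂ + x₃α)β, multiplied out.
  fromK : Kᴿ → Aᴿ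
  fromK ((x₀ , x₁) , (x₂ , x₃)) 0F 0F = x₀ , 0# , - x₃ , - (x₂ + x₃)
  fromK ((x₀ , x₁) , (x₂ , x₃)) 0F 1F = x₁ , x₁ , - (x₂ + x₃) , - x₃
  fromK ((x₀ , x₁) , (x₂ , x₃)) 1F 0F = x₁ , - x₁ , - (x₂ + x₃) , - x₃
  fromK ((x₀ , x₁) , (x₂ , x₃)) 1F 1F = x₀ , 0# , - (x₂ + x₃) , x₃

  u· : Aᴿ → Aᴿ
  u· x 0F l = ⊖ x 1F l
  u· x 1F l = -𝐢· x 0F l

  combine : (Fin 4 → Kᴿ) → Aᴿ
  combine d k l = fromK (d 0F) k l ⊕ (u· (fromK (d 1F)) k l ⊕ (u· (u· (fromK (d 2F))) k l ⊕ u· (u· (u· (fromK (d 3F)))) k l))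

  -- The coefficients x and z, read off the first row of x + u² z; here u² acts as 𝐢.
  real imaginary : H → H → Kᴿ
  real (a , b , c , d) (e , f , g , h) =
    (a , ½ * (e + f)) , (½ * (c + h + - g + - d) , ½ * - (c + h))
  imaginary (a , b , c , d) (e , f , g , h) =
    (b , ½ * (f + - e)) , (½ * (c + - h + - g + d) , ½ * (g + - d))

  -- On K + u²K the second row is determined by the first: r = (q₁, -q₀, q₂, q₃) and s = (p₀, p₁,
  -- p₃, -p₂). On uK + u³K the same relations hold with all signs reversed. Averaging therefore
  -- separates even from odd powers of u; `odd₁` and `odd₂` are the first row of the odd part after
  -- its leading u is removed.
  decompose : H → H → H → H → Fin 4 → Kᴿ
  decompose (p₀ , p₁ , p₂ , p₃) (q₀ , q₁ , q₂ , q₃) (r₀ , r₁ , r₂ , r₃) (s₀ , s₁ , s₂ , s₃) = coefficients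
    where
    even₁ even₂ odd₁ odd₂ : H
    even₁ = ½ * (p₀ + s₀) , ½ * (p₁ + s₁) , ½ * (p₂ + - s₃) , ½ * (p₃ + s₂)
    even₂ = ½ * (q₀ + - r₁) , ½ * (q₁ + r₀) , ½ * (q₂ + r₂) , ½ * (q₃ + r₃)
    odd₁  = ½ * - (q₀ + r₁) , ½ * (r₀ + - q₁) , ½ * (q₃ + - r₃) , ½ * (r₂ + - q₂)
    odd₂  = ½ * (p₁ + - s₁) , ½ * (s₀ + - p₀) , ½ * - (p₂ + s₃) , ½ * (s₂ + - p₃)
    coefficients : Fin 4 → Kᴿ
    coefficients 0F = real even₁ even₂
    coefficients 1F = real odd₁ odd₂
    coefficients 2F = imaginary even₁ even₂
    coefficients 3F = imaginary odd₁ odd₂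

-- The decomposition of M₂(ℍ) as a direct sum over powers of u

open QuaternionSolver
open Coordinates (DiscreteField.rawRing ℚ-field) ½

private
  module P = Coordinates (polynomials 16) (con ½)

  flatten : P.Kᴿ → ℍₚ {16}
  flatten ((x₀ , x₁) , (x₂ , x₃)) = x₀ , x₁ , x₂ , x₃

  d : Fin 4 → P.Kᴿ
  d 0F = (var 0F , var 1F) , (var 2F , var 3F)
  d 1F = (var 4F , var 5F) , (var 6F , var 7F)
  d 2F = (var 8F , var 9F) , (var (# 10) , var (# 11))
  d 3F = (var (# 12) , var (# 13)) , (var (# 14) , var (# 15))

  ρᴷ : (Fin 4 → K.Carrier) → Vec ℚ 16
  ρᴷ d = values (d 0F) (d 1F) (d 2F) (d 3F)
    where
    values : K.Carrier → K.Carrier → K.Carrier → K.Carrier → Vec ℚ 16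
    values ((a₀ , a₁) , (a₂ , a₃)) ((b₀ , b₁) , (b₂ , b₃)) ((c₀ , c₁) , (c₂ , c₃)) ((d₀ , d₁) , (d₂ , d₃)) =
      a₀ ∷ a₁ ∷ a₂ ∷ a₃ ∷ b₀ ∷ b₁ ∷ b₂ ∷ b₃ ∷ c₀ ∷ c₁ ∷ c₂ ∷ c₃ ∷ d₀ ∷ d₁ ∷ d₂ ∷ d₃ ∷ []

  unflatten : ∀ {x y : K.Carrier} →
    (proj₁ (proj₁ x) , proj₂ (proj₁ x) , proj₁ (proj₂ x) , proj₂ (proj₂ x)) ℍ.≈
    (proj₁ (proj₁ y) , proj₂ (proj₁ y) , proj₁ (proj₂ y) , proj₂ (proj₂ y)) → x K.≈ y
  unflatten (p₀ , p₁ , p₂ , p₃) = (p₀ , p₁) , (p₂ , p₃)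

abstract
  -- This half of the inverse pair gives uniqueness of the coefficients; `combine-decompose` gives
  -- their existence.
  decompose-combine : ∀ c j → decompose (combine c 0F 0F) (combine c 0F 1F) (combine c 1F 0F) (combine c 1F 1F) j K.≈ c j
  decompose-combine c = λ
    { 0F → unflatten (proveᴴ (flatten (d′ 0F)) (flatten (d 0F)) (ρᴷ c) rfl)
    ; 1F → unflatten (proveᴴ (flatten (d′ 1F)) (flatten (d 1F)) (ρᴷ c) rfl)
    ; 2F → unflatten (proveᴴ (flatten (d′ 2F)) (flatten (d 2F)) (ρᴷ c) rfl)
    ; 3F → unflatten (proveᴴ (flatten (d′ 3F)) (flatten (d 3F)) (ρᴷ c) rfl)
    }
    where
    d′ : Fin 4 → P.Kᴿ
    d′ = P.decompose (P.combine d 0F 0F) (P.combine d 0F 1F) (P.combine d 1F 0F) (P.combine d 1F 1F)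

private
  p q r s : ℍₚ {16}
  p = var 0F , var 1F , var 2F , var 3F
  q = var 4F , var 5F , var 6F , var 7F
  r = var 8F , var 9F , var (# 10) , var (# 11)
  s = var (# 12) , var (# 13) , var (# 14) , var (# 15)

  ρᴴ : ℍ.Carrier → ℍ.Carrier → ℍ.Carrier → ℍ.Carrier → Vec ℚ 16
  ρᴴ (p₀ , p₁ , p₂ , p₃) (q₀ , q₁ , q₂ , q₃) (r₀ , r₁ , r₂ , r₃) (s₀ , s₁ , s₂ , s₃) =
    p₀ ∷ p₁ ∷ p₂ ∷ p₃ ∷ q₀ ∷ q₁ ∷ q₂ ∷ q₃ ∷ r₀ ∷ r₁ ∷ r₂ ∷ r₃ ∷ s₀ ∷ s₁ ∷ s₂ ∷ s₃ ∷ []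

abstract
  combine-decompose : ∀ x → combine (decompose (x 0F 0F) (x 0F 1F) (x 1F 0F) (x 1F 1F)) A.≈ x
  combine-decompose x = entrywise
    (proveᴴ (x′ 0F 0F) p ρ rfl) (proveᴴ (x′ 0F 1F) q ρ rfl) (proveᴴ (x′ 1F 0F) r ρ rfl) (proveᴴ (x′ 1F 1F) s ρ rfl)
    where
    ρ : Vec ℚ 16
    ρ = ρᴴ (x 0F 0F) (x 0F 1F) (x 1F 0F) (x 1F 1F)
    x′ : P.Aᴿ
    x′ = P.combine (P.decompose p q r s)

  decompose-cong : ∀ {x y : A.Carrier} → x A.≈ y → ∀ j →
    decompose (x 0F 0F) (x 0F 1F) (x 1F 0F) (x 1F 1F) j K.≈ decompose (y 0F 0F) (y 0F 1F) (y 1F 0F) (y 1F 1F) j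
  decompose-cong x≈y j = go (x≈y 0F 0F) (x≈y 0F 1F) (x≈y 1F 0F) (x≈y 1F 1F)
    where
    go : ∀ {a b c d a′ b′ c′ d′} → a ℍ.≈ a′ → b ℍ.≈ b′ → c ℍ.≈ c′ → d ℍ.≈ d′ →
         decompose a b c d j K.≈ decompose a′ b′ c′ d′ j
    go rfl rfl rfl rfl = K.refl

-- Mirrors the definition of K→A, so that its values are those of K→A by computation.
private
  module P₄ = Coordinates (polynomials 4) (con ½)

  infixl 7 _:*ᴬ_
  _:*ᴬ_ : P₄.Aᴿ → P₄.Aᴿ → P₄.Aᴿ
  (x :*ᴬ y) i j = x i 0F :⊗ y 0F j :⊕ (x i 1F :⊗ y 1F j :⊕ (con 0ℚ , con 0ℚ , con 0ℚ , con 0ℚ))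

  :scalar : Polynomial 4 → P₄.Aᴿ
  :scalar c 0F 0F = c , con 0ℚ , con 0ℚ , con 0ℚ
  :scalar c 0F 1F = con 0ℚ , con 0ℚ , con 0ℚ , con 0ℚ
  :scalar c 1F 0F = con 0ℚ , con 0ℚ , con 0ℚ , con 0ℚ
  :scalar c 1F 1F = c , con 0ℚ , con 0ℚ , con 0ℚ

  :constant : A.Carrier → P₄.Aᴿ
  :constant x i j = let a , b , c , d = x i j in con a , con b , con c , con d

  :K→A : P₄.Aᴿ
  :K→A i j = :scalar (var 0F) i j :⊕ (:scalar (var 1F) :*ᴬ :constant α) i j
    :⊕ ((λ k l → :scalar (var 2F) k l :⊕ (:scalar (var 3F) :*ᴬ :constant α) k l) :*ᴬ :constant β) i j

abstract
  K→A≈fromK : ∀ x → K→A x A.≈ fromK x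
  K→A≈fromK ((x₀ , x₁) , (x₂ , x₃)) = entrywise
    (proveᴴ (:K→A 0F 0F) (explicit 0F 0F) ρ rfl) (proveᴴ (:K→A 0F 1F) (explicit 0F 1F) ρ rfl)
    (proveᴴ (:K→A 1F 0F) (explicit 1F 0F) ρ rfl) (proveᴴ (:K→A 1F 1F) (explicit 1F 1F) ρ rfl)
    where
    ρ : Vec ℚ 4
    ρ = x₀ ∷ x₁ ∷ x₂ ∷ x₃ ∷ []
    explicit : P₄.Aᴿ
    explicit = P₄.fromK ((var 0F , var 1F) , (var 2F , var 3F))

private
  u·-cong : ∀ {x y : A.Carrier} → x A.≈ y → u· x A.≈ u· y
  u·-cong {x} {y} x≈y = λ { 0F l → ⊖-cong (x≈y 1F l) ; 1F l → -𝐢·-cong (x≈y 0F l) }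
    where
    ⊖-cong : ∀ {a b} → a ℍ.≈ b → ⊖ a ℍ.≈ ⊖ b
    ⊖-cong rfl = rfl
    -𝐢·-cong : ∀ {a b} → a ℍ.≈ b → -𝐢· a ℍ.≈ -𝐢· b
    -𝐢·-cong rfl = rfl

abstract
  -- Left multiplication acts on each column separately, so eight variables, the coordinates of one
  -- column, are enough.
  u*≈u· : ∀ x → u A.* x A.≈ u· x
  u*≈u· x = λ
    { 0F l → proveᴴ {8} (:u 0F 0F :⊗ y :⊕ (:u 0F 1F :⊗ z :⊕ :0)) (Coordinates.⊖_ (polynomials 8) (con ½) z) (ρ (x 0F l) (x 1F l)) rfl
    ; 1F l → proveᴴ {8} (:u 1F 0F :⊗ y :⊕ (:u 1F 1F :⊗ z :⊕ :0)) (Coordinates.-𝐢·_ (polynomials 8) (con ½) y) (ρ (x 0F l) (x 1F l)) rfl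
    }
    where
    y z :0 : ℍₚ {8}
    y = var 0F , var 1F , var 2F , var 3F
    z = var 4F , var 5F , var 6F , var 7F
    :0 = con 0ℚ , con 0ℚ , con 0ℚ , con 0ℚ
    :u : Fin 2 → Fin 2 → ℍₚ {8}
    :u k l = let a , b , c , d = u k l in con a , con b , con c , con d
    ρ : ℍ.Carrier → ℍ.Carrier → Vec ℚ 8
    ρ (y₀ , y₁ , y₂ , y₃) (z₀ , z₁ , z₂ , z₃) = y₀ ∷ y₁ ∷ y₂ ∷ y₃ ∷ z₀ ∷ z₁ ∷ z₂ ∷ z₃ ∷ []

uʲ* : ∀ j {x y} → x A.≈ y → u A.^ j A.* x A.≈ fold y u· j
uʲ* zero {x} {y} x≈y = A.trans {A.1# A.* x} {x} {y} (A.*-identityˡ x) x≈y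
uʲ* (suc j) {x} {y} x≈y = A.trans {u A.* u A.^ j A.* x} {u A.* (u A.^ j A.* x)} {u· (fold y u· j)}
  (A.*-assoc u (u A.^ j) x)
  (A.trans {u A.* (u A.^ j A.* x)} {u· (u A.^ j A.* x)} {u· (fold y u· j)}
    (u*≈u· (u A.^ j A.* x)) (u·-cong (uʲ* j x≈y)))

sum≈combine : ∀ d → A.sum (λ j → u A.^ toℕ j A.* K→A (d j)) A.≈ combine d
-- The library sum ends in a summand 0 that `combine` does not have; `_+0` removes it.
sum≈combine d k l = term 0F ⊞ term 1F ⊞ term 2F ⊞ term 3F +0
  where
  term : ∀ j → (u A.^ toℕ j A.* K→A (d j)) k l ℍ.≈ fold (fromK (d j)) u· (toℕ j) k l
  term j = uʲ* (toℕ j) (K→A≈fromK (d j)) k l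
  _⊞_ : ∀ {a b a′ b′} → a ℍ.≈ a′ → b ℍ.≈ b′ → a ℍ.+ b ℍ.≈ a′ ℍ.+ b′
  rfl ⊞ rfl = rfl
  _+0 : ∀ {a a′} → a ℍ.≈ a′ → a ℍ.+ ℍ.0# ℍ.≈ a′
  _+0 {a} {a′} a≈a′ = ℍ.trans {a ℍ.+ ℍ.0#} {a} {a′} (ℍ.+-identityʳ a) a≈a′
  infixr 6 _⊞_
  infix 7 _+0

abstract
  decomposition : ∀ a → ∃! (Pointwise K._≈_) λ (d : Vector K.Carrier 4) →
                  A.sum (λ j → u A.^ toℕ j A.* K→A (d j)) A.≈ a
  decomposition a = decomposed a ,
    A.trans {total (decomposed a)} {combine (decomposed a)} {a} (sum≈combine (decomposed a)) (combine-decompose a) ,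
    λ {d} d-sums j → K.trans (decompose-cong {a} {combine d}
      (A.trans {a} {total d} {combine d} (A.sym {total d} {a} d-sums) (sum≈combine d)) j) (decompose-combine d j)
    where
    total : Vector K.Carrier 4 → A.Carrier
    total d = A.sum (λ j → u A.^ toℕ j A.* K→A (d j))
    decomposed : A.Carrier → Vector K.Carrier 4
    decomposed x = decompose (x 0F 0F) (x 0F 1F) (x 1F 0F) (x 1F 1F)

M₂ℍ-isCyclicAlgebra : IsCyclicAlgebra K/ℚ 4 σᴳ (ℚ.- 1ℚ) M₂ℍ
M₂ℍ-isCyclicAlgebra = record
  { embedL = K→A
  ; isRingHomomorphism = K→A-isRingHomomorphism
  ; embedL-algebraMap = K→A-algebraMap
  ; u = u
  ; u⁻¹ = u⁻¹
  ; inverseˡ = u⁻¹u≈1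
  ; inverseʳ = uu⁻¹≈1
  ; conjugation = conjugation
  ; power = u⁴≈-1
  ; decomposition = decomposition
  }

ℚ-hasNotCharacteristic-2 : ¬ HasCharacteristic ℚᶠ 2
ℚ-hasNotCharacteristic-2 char≡2 = contradiction (Equivalence.from (char≡2 2) ∣-refl) λ ()

-1-isPrimitiveRoot : IsPrimitiveRoot ℚᶠ 2 (ℚ.- 1ℚ)
-1-isPrimitiveRoot = refl , λ
  { 1 _ _ ()
  ; (ℕ.suc (ℕ.suc _)) _ (ℕ.s≤s (ℕ.s≤s ())) _
  }

M₂ℍ-isSchurIndex-2 : IsSchurIndex M₂ℍ 2
M₂ℍ-isSchurIndex-2 = 2 , quaternions , quaternions-isDivisionAlgebra , quaternions-hasDimension-4 , isMatrixAlgebra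

open import Data.Nat.Base using (_≤_; _<_; _^_; _+_)

mainTheorem4 : ∃[ p ] ∃[ n ] Prime p × 1 ≤ n ×
    Σ[ F ∈ Field ] Σ[ K ∈ Field ] Σ[ K/F ∈ Extension F K ] Σ[ σ ∈ Gal K/F ]
    IsCyclicGalois K/F (p ^ n) σ ×
    ¬ HasCharacteristic F p ×
    Σ[ ξ ∈ Field.Carrier F ] IsPrimitiveRoot F p ξ ×
    Σ[ T ∈ Tower K/F p n ] Σ[ m ∈ ℕ ] IsM T ξ [ m ] ×
    Σ[ A ∈ Algebra F ] IsCyclicAlgebra K/F (p ^ n) σ ξ A ×
    ∃[ d ] IsSchurIndex A d × d < p ^ (m + 1)
mainTheorem4 =
  2 , 2 , 2-prime , ℕ.s≤s ℕ.z≤n ,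
  ℚᶠ , Kᶠ , K/ℚ , σᴳ ,
  (K/ℚ-hasDegree-4 , K/ℚ-isGalois , K/ℚ-isGenerator) ,
  ℚ-hasNotCharacteristic-2 ,
  ℚ.- 1ℚ , -1-isPrimitiveRoot ,
  ℚ⊂L⊂K , 1 , m[K/ℚ]≡1 ,
  M₂ℍ , M₂ℍ-isCyclicAlgebra ,
  2 , M₂ℍ-isSchurIndex-2 , ℕ.s≤s (ℕ.s≤s (ℕ.s≤s ℕ.z≤n))
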